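{- Let $a,b,c$ be positive integers, $q_1,\dots,q_c\in(0,1)$, and let $\pi$ be distributed according to the $g$-measure $\mathrm P_{g,b,c}$ on $\mathrm{PP}(\infty,b,c)$, with shape $\lambda=(\lambda_1\ge\cdots\ge\lambda_b\ge0)$. Then $$\mathrm P_{g,b,c}(\lambda_1\le a)=\frac{1}{Z_{b,c}}\,s_{(a^b)}(1^b,q_1,\dots,q_c),$$ where $s_{(a^b)}$ is the Schur polynomial of the rectangular partition with $b$ parts equal to $a$, and $1^b$ denotes $b$ variables equal to $1$.
   Context: $\mathrm{PP}(\infty,b,c)$ is the set of plane partitions (arrays $(\pi_{ij})_{i,j\ge1}$ of nonnegative integers, finitely many nonzero, weakly decreasing along rows and columns) with at most $b$ nonzero rows and entries at most $c$; the shape of $\pi$ is the partition $\lambda$ with $\lambda_i=|\{j:\pi_{ij}>0\}|$. $\mathrm{Des}(\pi)=\{(i,j):\pi_{ij}>\pi_{i+1,j}\}$. The $g$-measure is $\mathrm P_{g,b,c}(\pi)=Z_{b,c}^{ -1}\prod_{(i,j)\in\mathrm{Des}(\pi)}q_{\pi_{ij}}$, where $Z_{b,c}$ is the normalizing constant. -}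

module Defs where

open import Level using (Level)
open import Data.Bool using (Bool; true; false; if_then_else_; _∧_)
open import Data.Nat as ℕ using (ℕ; zero; suc; _<ᵇ_; _≤ᵇ_; _<?_)
open import Data.Fin as Fin using (Fin; zero; suc; toℕ; fromℕ<; splitAt)
open import Data.Sum using ([_,_]′)
open import Data.List using (List; []; _∷_; [_]; map; concatMap; foldr; filterᵇ; allFin)
open import Data.Vec.Functional using () renaming (_∷_ to _∷ᶠ_)
open import Relation.Nullary.Decidable using (yes; no)
open import Algebra.Bundles using (CommutativeRing)

allFuns : ∀ {a} {A : Set a} (n : ℕ) → List A → List (Fin n → A)
allFuns zero    xs = [ (λ ()) ]
allFuns (suc n) xs = concatMap (λ x → map (λ f → x ∷ᶠ f) (allFuns n xs)) xs

Array : ∀ {ℓ} → ℕ → ℕ → Set ℓ → Set ℓ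
Array b a A = Fin b → Fin a → A

allArrays : ∀ {ℓ} {A : Set ℓ} (b a : ℕ) → List A → List (Array b a A)
allArrays b a xs = allFuns b (allFuns a xs)

∀ᵇ : (n : ℕ) → (Fin n → Bool) → Bool
∀ᵇ n p = foldr (λ i r → p i ∧ r) true (allFin n)

-- Plane partitions with λ₁ ≤ a, at most b nonzero rows, entries ≤ c.
-- Such a plane partition is determined by its restriction to the
-- b × a box (all entries outside are 0), with entries in {0,…,c},
-- represented as Fin (suc c).

isPP : ∀ {b a c} → Array b a (Fin (suc c)) → Bool
isPP {b} {a} π =
  ∀ᵇ b λ i → ∀ᵇ b λ i' → ∀ᵇ a λ j → ∀ᵇ a λ j' →
    if (toℕ i ≤ᵇ toℕ i') ∧ (toℕ j ≤ᵇ toℕ j')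
      then toℕ (π i' j') ≤ᵇ toℕ (π i j)
      else true

-- π_{i+1,j}, where row b+1 (outside the box) is identically 0
below : ∀ {b a c} → Array b a (Fin (suc c)) → Fin b → Fin a → ℕ
below {b} π i j with suc (toℕ i) <? b
... | yes p = toℕ (π (fromℕ< p) j)
... | no  _ = 0

isDes : ∀ {b a c} → Array b a (Fin (suc c)) → Fin b → Fin a → Bool
isDes π i j = below π i j <ᵇ toℕ (π i j)

module _ {c₀ ℓ₀ : Level} (R : CommutativeRing c₀ ℓ₀) where
  open CommutativeRing R

  Σ' : ∀ {ℓ} {A : Set ℓ} → List A → (A → Carrier) → Carrier
  Σ' xs f = foldr (λ x s → f x + s) 0# xs

  Π' : ∀ {ℓ} {A : Set ℓ} → List A → (A → Carrier) → Carrier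
  Π' xs f = foldr (λ x s → f x * s) 1# xs

  -- q_k for an entry k ∈ {1,…,c}; an entry 0 is never a descent
  qAt : ∀ {c} → (Fin c → Carrier) → Fin (suc c) → Carrier
  qAt q zero    = 1#
  qAt q (suc k) = q k

  gWeight : ∀ {b a c} → (Fin c → Carrier) → Array b a (Fin (suc c)) → Carrier
  gWeight {b} {a} q π =
    Π' (allFin b) λ i → Π' (allFin a) λ j →
      if isDes π i j then qAt q (π i j) else 1#

  -- Σ_{π ∈ PP(∞,b,c), λ₁(π) ≤ a} ∏_{(i,j) ∈ Des(π)} q_{π_{ij}}
  --   (= Z_{b,c} · P_{g,b,c}(λ₁ ≤ a))
  gWeightλ₁≤ : (a b c : ℕ) → (Fin c → Carrier) → Carrier
  gWeightλ₁≤ a b c q =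
    Σ' (filterᵇ isPP (allArrays b a (allFin (suc c)))) (gWeight q)

  isSSYT : ∀ {b a n} → Array b a (Fin n) → Bool
  isSSYT {b} {a} T =
    ∀ᵇ b λ i → ∀ᵇ b λ i' → ∀ᵇ a λ j → ∀ᵇ a λ j' →
      (if (toℕ j ≤ᵇ toℕ j') then toℕ (T i j) ≤ᵇ toℕ (T i j') else true) ∧
      (if (toℕ i <ᵇ toℕ i') then toℕ (T i j) <ᵇ toℕ (T i' j) else true)

  schurRect : (a b n : ℕ) → (Fin n → Carrier) → Carrier
  schurRect a b n x =
    Σ' (filterᵇ isSSYT (allArrays b a (allFin n))) λ T →
      Π' (allFin b) λ i → Π' (allFin a) λ j → x (T i j)

  onesThen : (b c : ℕ) → (Fin c → Carrier) → Fin (b ℕ.+ c) → Carrier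
  onesThen b c q k = [ (λ _ → 1#) , q ]′ (splitAt b k)

{-# OPTIONS --safe #-}

-- Cutting a plane partition into its level sets {π ≥ k} turns the left-hand side into
-- (1 ⋯ 1) G(q₁) ⋯ G(q_c) evaluated at ∅, where the kernel G(q) on partitions inside the
-- rectangle (a^b) is the one-variable skew dual Grothendieck polynomial; in G a row that
-- grows too long pushes the row above it. A semistandard tableau becomes in the same way
-- a chain of horizontal strips from ∅ to (a^b), with kernel H(x), in which a row is
-- instead blocked by the row above it. The kernel E of elegant fillings satisfies
-- G(q) E = E H(q) and fixes ∅, and its column sums are the row of H(1)^b indexed by (a^b).
-- As the H(x) commute, both sides equal the ((a^b), ∅) entry of H(1)^b H(q₁) ⋯ H(q_c).
-- Commutation of the H(x) and the intertwining relation both come from one identity for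
-- two strips under a cap on the first row, proved row by row by reversing an interval.

module Submission where

open import Defs
open import Level using (Level)
open import Data.Bool using (Bool; true; false; if_then_else_; _∧_; _∨_; not; T)
open import Data.Bool.Properties using (T-∧; ∧-commutativeMonoid; ∨-identityʳ; not-involutive)
open import Data.Nat using (ℕ; zero; suc; _+_; _∸_; _⊔_; _⊓_; _≤_; _<_; _≤ᵇ_; _<ᵇ_; _≡ᵇ_; z≤n; s≤s; _<?_)
import Data.Nat.Properties as ℕ
open import Data.Fin using (Fin; zero; suc; toℕ; fromℕ; fromℕ<; splitAt)
open import Data.Fin.Properties using (toℕ<n; toℕ≤pred[n]; toℕ-fromℕ; toℕ-fromℕ<; toℕ-injective)
open import Data.List using (List; []; _∷_; map; concatMap; _++_; foldr; filterᵇ; allFin; tabulate)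
open import Data.Vec using (Vec; []; _∷_) renaming (tabulate to tabulateᵛ)
open import Data.Vec.Functional using () renaming (_∷_ to _∷ᶠ_)
open import Data.Product using (_×_; _,_; proj₁; proj₂)
open import Data.Sum using (_⊎_; inj₁; inj₂; [_,_]′)
open import Data.Unit using (tt)
open import Data.Empty using (⊥-elim)
open import Function using (_∘_; id; Equivalence)
open import Relation.Nullary using (yes; no)
open import Relation.Binary.PropositionalEquality as ≡ using (_≡_)
open import Algebra.Bundles using (CommutativeRing; CommutativeMonoid)
import Algebra.Properties.CommutativeSemigroup as CommutativeSemigroupProperties
import Algebra.Properties.Semiring.Exp as Exp
import Algebra.Solver.CommutativeMonoid as CommutativeMonoidSolver
import Relation.Binary.Reasoning.Setoid as SetoidReasoning

-- Commutation of the H(x) is not stable under removing the first row: what remains of the second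
-- strip is bounded by the removed row, so the induction needs a cap. Under a cap the two orders of
-- the weights p and q differ, but only by monomials: H(p) followed by the capped H(q), times q to
-- the power by which the first outer row exceeds the cap, is symmetric in p and q. This defect is
-- exactly the difference between pushing and blocking, since max(m,h) - m is h - m truncated at 0.
-- In the intertwining relation one of the two strips comes from E and has weight 1, so one of the
-- powers disappears; and E freezes the first row, so the length h in the pushing weight can be read
-- on either side of E.
--
-- The b ones have a combinatorial source. In a tableau of shape (a^b)/μ with letters 1 to b, row i
-- holds only letters up to i, because its columns run down to row b. The cells of row i with letter
-- exactly i cut off a shape λ, and the smaller letters form an elegant filling of λ/μ. Summing over
-- λ gives the column sum of E at μ.

private variable
  ℓ ℓ′ : Level
  A B : Set ℓ
  a b m n : ℕ

-- Booleans and finite iterated operations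

T-ext : ∀ {x y} → (T x → T y) → (T y → T x) → x ≡ y
T-ext {true}  {true}  f g = ≡.refl
T-ext {true}  {false} f g = ⊥-elim (f tt)
T-ext {false} {true}  f g = ⊥-elim (g tt)
T-ext {false} {false} f g = ≡.refl

T-∧⁺ : ∀ {x y} → T x → T y → T (x ∧ y)
T-∧⁺ p q = Equivalence.from T-∧ (p , q)

T-∧⁻ : ∀ {x y} → T (x ∧ y) → T x × T y
T-∧⁻ = Equivalence.to T-∧

module BigOp {c ℓ₀ : Level} (M : CommutativeMonoid c ℓ₀) where
  open CommutativeMonoid M
  open SetoidReasoning setoid
  open CommutativeSemigroupProperties commutativeSemigroup using (interchange)

  ⨁ : List A → (A → Carrier) → Carrier
  ⨁ xs f = foldr (λ x s → f x ∙ s) ε xs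

  ⨁-cong : (xs : List A) {f g : A → Carrier} → (∀ x → f x ≈ g x) → ⨁ xs f ≈ ⨁ xs g
  ⨁-cong []       f≈g = refl
  ⨁-cong (x ∷ xs) f≈g = ∙-cong (f≈g x) (⨁-cong xs f≈g)

  ⨁-ε : (xs : List A) {f : A → Carrier} → (∀ x → f x ≈ ε) → ⨁ xs f ≈ ε
  ⨁-ε []       f≈ε = refl
  ⨁-ε (x ∷ xs) f≈ε = trans (∙-cong (f≈ε x) (⨁-ε xs f≈ε)) (identityˡ ε)

  ⨁-∙ : (xs : List A) (f g : A → Carrier) → ⨁ xs (λ x → f x ∙ g x) ≈ ⨁ xs f ∙ ⨁ xs g
  ⨁-∙ []       f g = sym (identityˡ ε)
  ⨁-∙ (x ∷ xs) f g = trans (∙-congˡ (⨁-∙ xs f g)) (interchange _ _ _ _)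

  ⨁-comm : (xs : List A) (ys : List B) (f : A → B → Carrier) →
    ⨁ xs (λ x → ⨁ ys (f x)) ≈ ⨁ ys (λ y → ⨁ xs (λ x → f x y))
  ⨁-comm []       ys f = sym (⨁-ε ys (λ _ → refl))
  ⨁-comm (x ∷ xs) ys f = trans (∙-congˡ (⨁-comm xs ys f)) (sym (⨁-∙ ys _ _))

  ⨁-++ : (xs ys : List A) (f : A → Carrier) → ⨁ (xs ++ ys) f ≈ ⨁ xs f ∙ ⨁ ys f
  ⨁-++ []       ys f = sym (identityˡ _)
  ⨁-++ (x ∷ xs) ys f = trans (∙-congˡ (⨁-++ xs ys f)) (sym (assoc _ _ _))

  ⨁-map : (h : A → B) (xs : List A) (f : B → Carrier) → ⨁ (map h xs) f ≡ ⨁ xs (f ∘ h)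
  ⨁-map h []       f = ≡.refl
  ⨁-map h (x ∷ xs) f = ≡.cong (f (h x) ∙_) (⨁-map h xs f)

  ⨁-concatMap : (h : A → List B) (xs : List A) (f : B → Carrier) →
    ⨁ (concatMap h xs) f ≈ ⨁ xs (λ x → ⨁ (h x) f)
  ⨁-concatMap h []       f = refl
  ⨁-concatMap h (x ∷ xs) f = trans (⨁-++ (h x) (concatMap h xs) f) (∙-congˡ (⨁-concatMap h xs f))

  ⨁-tabulate : (h : Fin n → A) (f : A → Carrier) → ⨁ (tabulate h) f ≡ ⨁ (allFin n) (f ∘ h)
  ⨁-tabulate h f = go h id f (f ∘ h) (λ _ → ≡.refl)
    where
    -- Both tabulated functions are replaced by their tails in the induction, so neither can stay
    -- fixed as `id`.
    go : {A : Set ℓ} {B : Set ℓ′} (h : Fin n → A) (k : Fin n → B) (f : A → Carrier) (g : B → Carrier) →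
      (∀ i → f (h i) ≡ g (k i)) → ⨁ (tabulate h) f ≡ ⨁ (tabulate k) g
    go {n = zero}  h k f g eq = ≡.refl
    go {n = suc n} h k f g eq = ≡.cong₂ _∙_ (eq zero) (go (h ∘ suc) (k ∘ suc) f g (eq ∘ suc))

  ⨁-suc : (f : Fin (suc n) → Carrier) → ⨁ (allFin (suc n)) f ≡ f zero ∙ ⨁ (allFin n) (f ∘ suc)
  ⨁-suc f = ≡.cong (f zero ∙_) (⨁-tabulate suc f)

  ⨁-allFuns : (n : ℕ) (xs : List A) (F : (Fin (suc n) → A) → Carrier) →
    ⨁ (allFuns (suc n) xs) F ≈ ⨁ xs (λ x → ⨁ (allFuns n xs) (λ f → F (x ∷ᶠ f)))
  ⨁-allFuns n xs F = trans (⨁-concatMap _ xs F)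
    (⨁-cong xs (λ x → reflexive (⨁-map (x ∷ᶠ_) (allFuns n xs) F)))

∀ᵇ-suc : (p : Fin (suc n) → Bool) → ∀ᵇ (suc n) p ≡ p zero ∧ ∀ᵇ n (p ∘ suc)
∀ᵇ-suc = BigOp.⨁-suc ∧-commutativeMonoid

∀ᵇ⁻ : (p : Fin n → Bool) → T (∀ᵇ n p) → ∀ i → T (p i)
∀ᵇ⁻ p t zero    = proj₁ (T-∧⁻ (≡.subst T (∀ᵇ-suc p) t))
∀ᵇ⁻ p t (suc i) = ∀ᵇ⁻ (p ∘ suc) (proj₂ (T-∧⁻ {p zero} (≡.subst T (∀ᵇ-suc p) t))) i

∀ᵇ⁺ : (p : Fin n → Bool) → (∀ i → T (p i)) → T (∀ᵇ n p)
∀ᵇ⁺ {zero}  p t = tt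
∀ᵇ⁺ {suc n} p t = ≡.subst T (≡.sym (∀ᵇ-suc p)) (T-∧⁺ (t zero) (∀ᵇ⁺ (p ∘ suc) (t ∘ suc)))

-- Sums, products and Boolean guards in the ring

module RingSums {c ℓ₀ : Level} (R : CommutativeRing c ℓ₀) where
  open CommutativeRing R hiding (_+_; zero)
  open Exp semiring public using (_^_)
  open SetoidReasoning setoid
  open BigOp +-commutativeMonoid public
    renaming (⨁ to ∑; ⨁-cong to ∑-cong; ⨁-ε to ∑-0; ⨁-comm to ∑-comm; ⨁-map to ∑-map;
              ⨁-suc to ∑-suc; ⨁-allFuns to ∑-allFuns)
    hiding (⨁-∙; ⨁-++; ⨁-concatMap; ⨁-tabulate)
  open BigOp *-commutativeMonoid public
    renaming (⨁ to ∏; ⨁-cong to ∏-cong; ⨁-ε to ∏-1; ⨁-∙ to ∏-*; ⨁-comm to ∏-comm; ⨁-suc to ∏-suc)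
    hiding (⨁-++; ⨁-concatMap; ⨁-map; ⨁-tabulate; ⨁-allFuns)

  *-∑ : (k : Carrier) (xs : List A) (f : A → Carrier) → k * ∑ xs f ≈ ∑ xs (λ x → k * f x)
  *-∑ k []       f = zeroʳ k
  *-∑ k (x ∷ xs) f = trans (distribˡ k _ _) (+-congˡ (*-∑ k xs f))

  ∑-* : (k : Carrier) (xs : List A) (f : A → Carrier) → ∑ xs f * k ≈ ∑ xs (λ x → f x * k)
  ∑-* k xs f = trans (*-comm _ k) (trans (*-∑ k xs f) (∑-cong xs (λ _ → *-comm k _)))

  ∑-*-∑ : (xs : List A) (ys : List B) (f : A → Carrier) (g : B → Carrier) →
    ∑ xs (λ x → ∑ ys (λ y → f x * g y)) ≈ ∑ xs f * ∑ ys g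
  ∑-*-∑ xs ys f g = sym (trans (∑-* _ xs f) (∑-cong xs (λ x → *-∑ (f x) ys g)))

  ∑-∏ : (n : ℕ) (xs : List A) (g : Fin n → A → Carrier) →
    ∑ (allFuns n xs) (λ f → ∏ (allFin n) (λ i → g i (f i))) ≈ ∏ (allFin n) (λ i → ∑ xs (g i))
  ∑-∏ zero    xs g = +-identityʳ 1#
  ∑-∏ (suc n) xs g = begin
    ∑ (allFuns (suc n) xs) (λ f → ∏ (allFin (suc n)) (λ i → g i (f i)))
      ≈⟨ ∑-allFuns n xs _ ⟩
    ∑ xs (λ x → ∑ (allFuns n xs) (λ f → ∏ (allFin (suc n)) (λ i → g i ((x ∷ᶠ f) i))))
      ≈⟨ ∑-cong xs (λ x → ∑-cong (allFuns n xs) (λ f → reflexive (∏-suc (λ i → g i ((x ∷ᶠ f) i))))) ⟩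
    ∑ xs (λ x → ∑ (allFuns n xs) (λ f → g zero x * ∏ (allFin n) (λ i → g (suc i) (f i))))
      ≈⟨ ∑-*-∑ xs (allFuns n xs) _ _ ⟩
    ∑ xs (g zero) * ∑ (allFuns n xs) (λ f → ∏ (allFin n) (λ i → g (suc i) (f i)))
      ≈⟨ *-congˡ (∑-∏ n xs (g ∘ suc)) ⟩
    ∑ xs (g zero) * ∏ (allFin n) (λ i → ∑ xs (g (suc i)))
      ≡⟨ ∏-suc (λ i → ∑ xs (g i)) ⟨
    ∏ (allFin (suc n)) (λ i → ∑ xs (g i)) ∎

  ∑-∏∏ : (m n : ℕ) (xs : List A) (g : Fin m → Fin n → A → Carrier) →
    ∑ (allArrays m n xs) (λ L → ∏ (allFin m) (λ i → ∏ (allFin n) (λ j → g i j (L i j)))) ≈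
    ∏ (allFin m) (λ i → ∏ (allFin n) (λ j → ∑ xs (g i j)))
  ∑-∏∏ m n xs g = trans (∑-∏ m (allFuns n xs) _) (∏-cong (allFin m) (λ i → ∑-∏ n xs (g i)))

  ⟦_⟧ : Bool → Carrier
  ⟦ x ⟧ = if x then 1# else 0#

  ⟦⟧-∧ : ∀ x y → ⟦ x ∧ y ⟧ ≈ ⟦ x ⟧ * ⟦ y ⟧
  ⟦⟧-∧ true  y = sym (*-identityˡ _)
  ⟦⟧-∧ false y = sym (zeroˡ _)

  ⟦⟧-T : ∀ {x} → T x → ⟦ x ⟧ ≈ 1#
  ⟦⟧-T {true} _ = refl

  guard : ∀ x {u v} → (T x → u ≈ v) → ⟦ x ⟧ * u ≈ ⟦ x ⟧ * v
  guard true  u≈v = *-congˡ (u≈v tt)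
  guard false u≈v = trans (zeroˡ _) (sym (zeroˡ _))

  guard-≡ : ∀ {x y u v} → x ≡ y → (T x → u ≈ v) → ⟦ x ⟧ * u ≈ ⟦ y ⟧ * v
  guard-≡ {x} ≡.refl = guard x

  guard-dichotomy : ∀ x {u} → ⟦ x ⟧ * u ≈ 0# ⊎ T x
  guard-dichotomy true  = inj₂ tt
  guard-dichotomy false = inj₁ (zeroˡ _)

  ∏-⟦⟧ : (p : Fin n → Bool) → ∏ (allFin n) (λ i → ⟦ p i ⟧) ≈ ⟦ ∀ᵇ n p ⟧
  ∏-⟦⟧ {zero}  p = refl
  ∏-⟦⟧ {suc n} p = begin
    ∏ (allFin (suc n)) (λ i → ⟦ p i ⟧)             ≡⟨ ∏-suc (λ i → ⟦ p i ⟧) ⟩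
    ⟦ p zero ⟧ * ∏ (allFin n) (λ i → ⟦ p (suc i) ⟧) ≈⟨ *-congˡ (∏-⟦⟧ (p ∘ suc)) ⟩
    ⟦ p zero ⟧ * ⟦ ∀ᵇ n (p ∘ suc) ⟧                 ≈⟨ ⟦⟧-∧ (p zero) _ ⟨
    ⟦ p zero ∧ ∀ᵇ n (p ∘ suc) ⟧                     ≡⟨ ≡.cong ⟦_⟧ (∀ᵇ-suc p) ⟨
    ⟦ ∀ᵇ (suc n) p ⟧                                ∎

  ∏-guard : (p : Fin n → Bool) (w : Fin n → Carrier) →
    ∏ (allFin n) (λ i → ⟦ p i ⟧ * w i) ≈ ⟦ ∀ᵇ n p ⟧ * ∏ (allFin n) w
  ∏-guard {n} p w = trans (∏-* (allFin n) _ w) (*-congʳ (∏-⟦⟧ p))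

  ∑-filter : (p : A → Bool) (xs : List A) (f : A → Carrier) →
    ∑ (filterᵇ p xs) f ≈ ∑ xs (λ x → ⟦ p x ⟧ * f x)
  ∑-filter p []       f = refl
  ∑-filter p (x ∷ xs) f with p x
  ... | true  = +-cong (sym (*-identityˡ _)) (∑-filter p xs f)
  ... | false = trans (∑-filter p xs f) (sym (trans (+-congʳ (zeroˡ _)) (+-identityˡ _)))

  -- K is a coupling of the two index sets: a 0/1 kernel with unit marginals.
  ∑-coupling : (xs : List A) (ys : List B) (f : A → Carrier) (g : B → Carrier) (K : A → B → Carrier) →
    (∀ x → f x ≈ 0# ⊎ ∑ ys (K x) ≈ 1#) →
    (∀ y → g y ≈ 0# ⊎ ∑ xs (λ x → K x y) ≈ 1#) →
    (∀ x y → f x * K x y ≈ g y * K x y) → ∑ xs f ≈ ∑ ys g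
  ∑-coupling xs ys f g K fK gK f≈g = begin
    ∑ xs f                                ≈⟨ ∑-cong xs (λ x → absorb (fK x)) ⟩
    ∑ xs (λ x → f x * ∑ ys (K x))         ≈⟨ ∑-cong xs (λ x → *-∑ (f x) ys _) ⟩
    ∑ xs (λ x → ∑ ys (λ y → f x * K x y)) ≈⟨ ∑-comm xs ys _ ⟩
    ∑ ys (λ y → ∑ xs (λ x → f x * K x y)) ≈⟨ ∑-cong ys (λ y → ∑-cong xs (λ x → f≈g x y)) ⟩
    ∑ ys (λ y → ∑ xs (λ x → g y * K x y)) ≈⟨ ∑-cong ys (λ y → *-∑ (g y) xs _) ⟨
    ∑ ys (λ y → g y * ∑ xs (λ x → K x y)) ≈⟨ ∑-cong ys (λ y → absorb (gK y)) ⟨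
    ∑ ys g                                ∎
    where
    absorb : ∀ {u v} → u ≈ 0# ⊎ v ≈ 1# → u ≈ u * v
    absorb (inj₁ u≈0) = trans u≈0 (sym (trans (*-congʳ u≈0) (zeroˡ _)))
    absorb (inj₂ v≈1) = sym (trans (*-congˡ v≈1) (*-identityʳ _))

-- Shifted sequences and truncated subtraction

headOr : A → (Fin n → A) → A
headOr {n = zero}  d f = d
headOr {n = suc n} d f = f zero

-- The sequence shifted by one and closed off by a boundary value: length 0 below the last row, the
-- empty shape inside the last level set, the full rectangle outside the last strip of a tableau.
next : A → (Fin n → A) → Fin n → A
next d f zero    = headOr d (f ∘ suc)
next d f (suc i) = next d (f ∘ suc) i

≤ᵇ-suc : ∀ m n → (suc m ≤ᵇ suc n) ≡ (m ≤ᵇ n)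
≤ᵇ-suc zero    n = ≡.refl
≤ᵇ-suc (suc m) n = ≡.refl

m∸[m⊓n]+[m⊓n]∸k : ∀ {l k x} → x ≤ l → x ≤ k → (l ∸ k) + (l ⊓ k ∸ x) ≡ l ∸ x
m∸[m⊓n]+[m⊓n]∸k {l} {k} {x} x≤l x≤k with ℕ.≤-total l k
... | inj₁ l≤k = ≡.cong₂ _+_ (ℕ.m≤n⇒m∸n≡0 l≤k) (≡.cong (_∸ x) (ℕ.m≤n⇒m⊓n≡m l≤k))
... | inj₂ k≤l = ≡.trans (≡.cong (λ z → (l ∸ k) + (z ∸ x)) (ℕ.m≥n⇒m⊓n≡n k≤l))
  (≡.trans (≡.sym (ℕ.+-∸-assoc (l ∸ k) x≤k)) (≡.cong (_∸ x) (ℕ.m∸n+n≡m k≤l)))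

k∸m+x∸[m⊔k] : ∀ {x m k} → m ≤ x → k ≤ x → (k ∸ m) + (x ∸ (m ⊔ k)) ≡ x ∸ m
k∸m+x∸[m⊔k] {x} {m} {k} m≤x k≤x with ℕ.≤-total m k
... | inj₁ m≤k = ≡.trans (≡.cong (λ z → (k ∸ m) + (x ∸ z)) (ℕ.m≤n⇒m⊔n≡n m≤k))
  (≡.trans (ℕ.+-comm (k ∸ m) _) (≡.trans (≡.sym (ℕ.+-∸-assoc (x ∸ k) m≤k)) (≡.cong (_∸ m) (ℕ.m∸n+n≡m k≤x))))
... | inj₂ k≤m = ≡.cong₂ _+_ (ℕ.m≤n⇒m∸n≡0 k≤m) (≡.cong (x ∸_) (ℕ.m≥n⇒m⊔n≡m k≤m))

-- Symmetric two-variable sums over an interval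

module IntervalSums {c ℓ₀ : Level} (R : CommutativeRing c ℓ₀) where
  open CommutativeRing R hiding (_+_; zero)
  open CommutativeRing R using () renaming (_+_ to _⊕_)
  open RingSums R
  open SetoidReasoning setoid

  ∑-interval : ∀ a k n (F : ℕ → Carrier) → k + n ≤ a →
    ∑ (allFin (suc a)) (λ x → ⟦ (k ≤ᵇ toℕ x) ∧ (toℕ x ≤ᵇ k + n) ⟧ * F (toℕ x)) ≈
    ∑ (allFin (suc n)) (λ i → F (k + toℕ i))
  ∑-interval a zero zero F _ = begin
    ∑ (allFin (suc a)) (λ x → ⟦ toℕ x ≤ᵇ 0 ⟧ * F (toℕ x))              ≡⟨ ∑-suc {n = a} _ ⟩
    1# * F 0 ⊕ ∑ (allFin a) (λ x → ⟦ suc (toℕ x) ≤ᵇ 0 ⟧ * F (suc (toℕ x)))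
      ≈⟨ +-cong (*-identityˡ _) (∑-0 (allFin a) (λ _ → zeroˡ _)) ⟩
    F 0 ⊕ 0#                                                           ∎
  ∑-interval (suc a) zero (suc n) F (s≤s n≤a) = begin
    ∑ (allFin (suc (suc a))) (λ x → ⟦ toℕ x ≤ᵇ suc n ⟧ * F (toℕ x))     ≡⟨ ∑-suc {n = suc a} _ ⟩
    1# * F 0 ⊕ ∑ (allFin (suc a)) (λ x → ⟦ suc (toℕ x) ≤ᵇ suc n ⟧ * F (suc (toℕ x)))
      ≈⟨ +-cong (*-identityˡ _) (∑-cong (allFin (suc a)) (λ x →
           *-congʳ (reflexive (≡.cong ⟦_⟧ (≤ᵇ-suc (toℕ x) n))))) ⟩
    F 0 ⊕ ∑ (allFin (suc a)) (λ x → ⟦ toℕ x ≤ᵇ n ⟧ * F (suc (toℕ x)))  ≈⟨ +-congˡ (∑-interval a zero n (F ∘ suc) n≤a) ⟩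
    F 0 ⊕ ∑ (allFin (suc n)) (λ i → F (suc (toℕ i)))                   ≡⟨ ∑-suc {n = suc n} _ ⟨
    ∑ (allFin (suc (suc n))) (λ i → F (toℕ i))                         ∎
  ∑-interval (suc a) (suc k) n F (s≤s k+n≤a) = begin
    ∑ (allFin (suc (suc a))) (λ x → ⟦ (suc k ≤ᵇ toℕ x) ∧ (toℕ x ≤ᵇ suc k + n) ⟧ * F (toℕ x))
      ≡⟨ ∑-suc {n = suc a} _ ⟩
    0# * F 0 ⊕ ∑ (allFin (suc a)) (λ x → ⟦ (suc k ≤ᵇ suc (toℕ x)) ∧ (suc (toℕ x) ≤ᵇ suc k + n) ⟧ * F (suc (toℕ x)))
      ≈⟨ +-cong (zeroˡ _) (∑-cong (allFin (suc a)) (λ x →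
           *-congʳ (reflexive (≡.cong₂ (λ u v → ⟦ u ∧ v ⟧) (≤ᵇ-suc k (toℕ x)) (≤ᵇ-suc (toℕ x) (k + n)))))) ⟩
    0# ⊕ ∑ (allFin (suc a)) (λ x → ⟦ (k ≤ᵇ toℕ x) ∧ (toℕ x ≤ᵇ k + n) ⟧ * F (suc (toℕ x)))
      ≈⟨ +-identityˡ _ ⟩
    ∑ (allFin (suc a)) (λ x → ⟦ (k ≤ᵇ toℕ x) ∧ (toℕ x ≤ᵇ k + n) ⟧ * F (suc (toℕ x)))
      ≈⟨ ∑-interval a k n (F ∘ suc) k+n≤a ⟩
    ∑ (allFin (suc n)) (λ i → F (suc k + toℕ i)) ∎

  ∑-snoc : ∀ n (F : ℕ → Carrier) → ∑ (allFin (suc n)) (F ∘ toℕ) ≈ ∑ (allFin n) (F ∘ toℕ) ⊕ F n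
  ∑-snoc zero    F = trans (+-identityʳ _) (sym (+-identityˡ _))
  ∑-snoc (suc n) F = begin
    ∑ (allFin (suc (suc n))) (F ∘ toℕ)                   ≡⟨ ∑-suc {n = suc n} _ ⟩
    F 0 ⊕ ∑ (allFin (suc n)) (F ∘ suc ∘ toℕ)             ≈⟨ +-congˡ (∑-snoc n (F ∘ suc)) ⟩
    F 0 ⊕ (∑ (allFin n) (F ∘ suc ∘ toℕ) ⊕ F (suc n))     ≈⟨ +-assoc _ _ _ ⟨
    F 0 ⊕ ∑ (allFin n) (F ∘ suc ∘ toℕ) ⊕ F (suc n)       ≡⟨ ≡.cong (_⊕ F (suc n)) (∑-suc {n = n} _) ⟨
    ∑ (allFin (suc n)) (F ∘ toℕ) ⊕ F (suc n)             ∎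

  ∑-reverse : ∀ n (F : ℕ → Carrier) →
    ∑ (allFin (suc n)) (F ∘ toℕ) ≈ ∑ (allFin (suc n)) (λ i → F (n ∸ toℕ i))
  ∑-reverse zero    F = refl
  ∑-reverse (suc n) F = begin
    ∑ (allFin (suc (suc n))) (F ∘ toℕ)                   ≈⟨ ∑-snoc (suc n) F ⟩
    ∑ (allFin (suc n)) (F ∘ toℕ) ⊕ F (suc n)             ≈⟨ +-comm _ _ ⟩
    F (suc n) ⊕ ∑ (allFin (suc n)) (F ∘ toℕ)             ≈⟨ +-congˡ (∑-reverse n F) ⟩
    F (suc n) ⊕ ∑ (allFin (suc n)) (λ i → F (n ∸ toℕ i)) ≡⟨ ∑-suc {n = suc n} _ ⟨
    ∑ (allFin (suc (suc n))) (λ i → F (suc n ∸ toℕ i))   ∎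

  intervalSum : (a k l : ℕ) (p q : Carrier) → Carrier
  intervalSum a k l p q =
    ∑ (allFin (suc a)) (λ x → ⟦ (k ≤ᵇ toℕ x) ∧ (toℕ x ≤ᵇ l) ⟧ * (p ^ (l ∸ toℕ x) * q ^ (toℕ x ∸ k)))

  intervalSum-homogeneous : ∀ a k n p q → k + n ≤ a →
    intervalSum a k (k + n) p q ≈ ∑ (allFin (suc n)) (λ i → p ^ (n ∸ toℕ i) * q ^ toℕ i)
  intervalSum-homogeneous a k n p q k+n≤a = trans
    (∑-interval a k n (λ x → p ^ (k + n ∸ x) * q ^ (x ∸ k)) k+n≤a)
    (∑-cong (allFin (suc n)) (λ i → reflexive (≡.cong₂ (λ u v → p ^ u * q ^ v)
      (ℕ.[m+n]∸[m+o]≡n∸o k n (toℕ i)) (ℕ.m+n∸m≡n k (toℕ i)))))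

  -- For `k ≤ l` this is the complete homogeneous polynomial of degree l - k in p and q; `l ≤ a`
  -- keeps the whole interval inside the range of summation.
  intervalSum-comm : ∀ a k l p q → l ≤ a → intervalSum a k l p q ≈ intervalSum a k l q p
  intervalSum-comm a k l p q l≤a with ℕ.≤-total k l
  -- Only x = k = l can survive the guard, and there all exponents are 0.
  ... | inj₂ l≤k = ∑-cong (allFin (suc a)) (λ x → guard _ (λ t → let
      k≤x = ℕ.≤ᵇ⇒≤ k (toℕ x) (proj₁ (T-∧⁻ {k ≤ᵇ toℕ x} t))
      x≤l = ℕ.≤ᵇ⇒≤ (toℕ x) l (proj₂ (T-∧⁻ {k ≤ᵇ toℕ x} t))
      l∸x≡0 = ℕ.m≤n⇒m∸n≡0 (ℕ.≤-trans l≤k k≤x)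
      x∸k≡0 = ℕ.m≤n⇒m∸n≡0 (ℕ.≤-trans x≤l l≤k)
      in trans (reflexive (≡.cong₂ (λ u v → p ^ u * q ^ v) l∸x≡0 x∸k≡0))
           (sym (reflexive (≡.cong₂ (λ u v → q ^ u * p ^ v) l∸x≡0 x∸k≡0)))))
  ... | inj₁ k≤l with ℕ.m≤n⇒∃[o]m+o≡n k≤l
  ... | n , ≡.refl = begin
    intervalSum a k (k + n) p q
      ≈⟨ intervalSum-homogeneous a k n p q l≤a ⟩
    ∑ (allFin (suc n)) (λ i → p ^ (n ∸ toℕ i) * q ^ toℕ i)
      ≈⟨ ∑-reverse n (λ i → p ^ (n ∸ i) * q ^ i) ⟩
    ∑ (allFin (suc n)) (λ i → p ^ (n ∸ (n ∸ toℕ i)) * q ^ (n ∸ toℕ i))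
      ≈⟨ ∑-cong (allFin (suc n)) (λ i → trans (*-comm _ _)
           (reflexive (≡.cong (λ u → q ^ (n ∸ toℕ i) * p ^ u) (ℕ.m∸[m∸n]≡n (toℕ≤pred[n] i))))) ⟩
    ∑ (allFin (suc n)) (λ i → q ^ (n ∸ toℕ i) * p ^ toℕ i)
      ≈⟨ intervalSum-homogeneous a k n q p l≤a ⟨
    intervalSum a k (k + n) q p ∎

-- Branching kernels on partitions inside the rectangle

module Kernels {c ℓ₀ : Level} (R : CommutativeRing c ℓ₀) (a : ℕ) where
  open CommutativeRing R hiding (_+_; zero)
  open CommutativeRing R using () renaming (_+_ to _⊕_)
  open RingSums R
  open IntervalSums R
  open Exp semiring using (^-congʳ; ^-homo-*)
  open CommutativeSemigroupProperties *-commutativeSemigroup using (x∙yz≈y∙xz)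
  open SetoidReasoning setoid
  open CommutativeMonoidSolver *-commutativeMonoid using (solve; _⊜_) renaming (_⊕_ to _⊗_; id to 𝟏)

  entries : List (Fin (suc a))
  entries = allFin (suc a)

  Partition : ℕ → Set
  Partition = Vec (Fin (suc a))

  partitions : ∀ b → List (Partition b)
  partitions b = map tabulateᵛ (allFuns b entries)

  ∑-partitions : ∀ b (F : Partition b → Carrier) →
    ∑ (partitions b) F ≡ ∑ (allFuns b entries) (F ∘ tabulateᵛ)
  ∑-partitions b F = ∑-map tabulateᵛ (allFuns b entries) F

  ∑-partitions-∷ : ∀ b (F : Partition (suc b) → Carrier) →
    ∑ (partitions (suc b)) F ≈ ∑ entries (λ x → ∑ (partitions b) (λ v → F (x ∷ v)))
  ∑-partitions-∷ b F = begin
    ∑ (partitions (suc b)) F                    ≡⟨ ∑-partitions (suc b) F ⟩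
    ∑ (allFuns (suc b) entries) (F ∘ tabulateᵛ) ≈⟨ ∑-allFuns b entries _ ⟩
    ∑ entries (λ x → ∑ (allFuns b entries) (λ f → F (x ∷ tabulateᵛ f)))
      ≈⟨ ∑-cong entries (λ x → reflexive (∑-partitions b (F ∘ (x ∷_)))) ⟨
    ∑ entries (λ x → ∑ (partitions b) (λ v → F (x ∷ v))) ∎

  head₀ : Partition b → ℕ
  head₀ []      = 0
  head₀ (x ∷ _) = toℕ x

  Kernel : ℕ → Set c
  Kernel b = Partition b → Partition b → Carrier

  Row : ℕ → Set c
  Row b = Partition b → Carrier

  infixl 7 _◁_ _·_

  _◁_ : Row b → Kernel b → Row b
  _◁_ {b} u K m = ∑ (partitions b) (λ x → u x * K x m)

  _·_ : Kernel b → Kernel b → Kernel b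
  (K · L) l = K l ◁ L

  ◁-congˡ : {u v : Row b} (K : Kernel b) → (∀ x → u x ≈ v x) → ∀ m → (u ◁ K) m ≈ (v ◁ K) m
  ◁-congˡ {b} K u≈v m = ∑-cong (partitions b) (λ x → *-congʳ (u≈v x))

  ◁-congʳ : (u : Row b) {K L : Kernel b} → (∀ l m → K l m ≈ L l m) → ∀ m → (u ◁ K) m ≈ (u ◁ L) m
  ◁-congʳ {b} u K≈L m = ∑-cong (partitions b) (λ x → *-congˡ (K≈L x m))

  ◁-assoc : (u : Row b) (K L : Kernel b) → ∀ m → (u ◁ K ◁ L) m ≈ (u ◁ (K · L)) m
  ◁-assoc {b} u K L m = begin
    ∑ (partitions b) (λ y → ∑ (partitions b) (λ x → u x * K x y) * L y m)
      ≈⟨ ∑-cong (partitions b) (λ y → ∑-* _ (partitions b) _) ⟩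
    ∑ (partitions b) (λ y → ∑ (partitions b) (λ x → u x * K x y * L y m))
      ≈⟨ ∑-comm (partitions b) (partitions b) _ ⟩
    ∑ (partitions b) (λ x → ∑ (partitions b) (λ y → u x * K x y * L y m))
      ≈⟨ ∑-cong (partitions b) (λ x → trans (∑-cong (partitions b) (λ y → *-assoc _ _ _))
           (sym (*-∑ (u x) (partitions b) _))) ⟩
    ∑ (partitions b) (λ x → u x * ∑ (partitions b) (λ y → K x y * L y m)) ∎

  -- In the arguments l m h below, l and m are the new and the old length of a row
  -- and h is the new length of the row beneath it.
  rise : Carrier → (l m : ℕ) → Carrier
  rise y l m = ⟦ m ≤ᵇ l ⟧ * y ^ (l ∸ m)

  blockStep pushStep : Carrier → (l m h : ℕ) → Carrier
  blockStep y l m h = rise y l m * ⟦ h ≤ᵇ m ⟧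
  pushStep y l m h = ⟦ (m ≤ᵇ l) ∧ (h ≤ᵇ l) ⟧ * y ^ (l ∸ (m ⊔ h))

  -- The branching kernels of Schur and of dual Grothendieck polynomials.
  schurKernel grothKernel : Carrier → Kernel b
  schurKernel y []       []       = 1#
  schurKernel y (l ∷ ls) (m ∷ ms) = blockStep y (toℕ l) (toℕ m) (head₀ ls) * schurKernel y ls ms
  grothKernel y []       []       = 1#
  grothKernel y (l ∷ ls) (m ∷ ms) = pushStep y (toℕ l) (toℕ m) (head₀ ls) * grothKernel y ls ms

  -- Two horizontal strips under a cap on the first row

  capped : ℕ → Carrier → Kernel b
  capped cap y x m = ⟦ head₀ x ≤ᵇ cap ⟧ * schurKernel y x m

  rowSum : (p q : Carrier) (l h cap m : ℕ) → Carrier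
  rowSum p q l h cap m = ∑ entries (λ x → blockStep p l (toℕ x) h * (⟦ toℕ x ≤ᵇ cap ⟧ * rise q (toℕ x) m))

  -- The intermediate length x runs from `m ⊔ h` to `l ⊓ cap`. The parts of the exponents outside
  -- this interval do not depend on x and come out as powers; what stays is symmetric in p and q.
  rowSum≈intervalSum : ∀ p q l h cap m →
    rowSum p q l h cap m ≈ (p ^ (l ∸ cap) * q ^ (h ∸ m)) * intervalSum a (m ⊔ h) (l ⊓ cap) p q
  rowSum≈intervalSum p q l h cap m = begin
    rowSum p q l h cap m ≈⟨ ∑-cong entries (λ x → term (toℕ x)) ⟩
    ∑ entries (λ x → k * (⟦ (m ⊔ h ≤ᵇ toℕ x) ∧ (toℕ x ≤ᵇ l ⊓ cap) ⟧ *
                          (p ^ (l ⊓ cap ∸ toℕ x) * q ^ (toℕ x ∸ (m ⊔ h)))))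
      ≈⟨ *-∑ k entries _ ⟨
    k * intervalSum a (m ⊔ h) (l ⊓ cap) p q ∎
    where
    k = p ^ (l ∸ cap) * q ^ (h ∸ m)

    bounds : ∀ {x} → T (((x ≤ᵇ l) ∧ (h ≤ᵇ x)) ∧ ((x ≤ᵇ cap) ∧ (m ≤ᵇ x))) →
      (x ≤ l × h ≤ x) × (x ≤ cap × m ≤ x)
    bounds {x} t with T-∧⁻ {(x ≤ᵇ l) ∧ (h ≤ᵇ x)} t
    ... | t₁ , t₂ with T-∧⁻ {x ≤ᵇ l} t₁ | T-∧⁻ {x ≤ᵇ cap} t₂
    ... | u₁ , u₂ | u₃ , u₄ = (ℕ.≤ᵇ⇒≤ x l u₁ , ℕ.≤ᵇ⇒≤ h x u₂) , (ℕ.≤ᵇ⇒≤ x cap u₃ , ℕ.≤ᵇ⇒≤ m x u₄)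

    guards : ∀ x → (((x ≤ᵇ l) ∧ (h ≤ᵇ x)) ∧ ((x ≤ᵇ cap) ∧ (m ≤ᵇ x))) ≡ ((m ⊔ h ≤ᵇ x) ∧ (x ≤ᵇ l ⊓ cap))
    guards x = T-ext
      (λ t → let (x≤l , h≤x) , (x≤cap , m≤x) = bounds t in
        T-∧⁺ (ℕ.≤⇒≤ᵇ (ℕ.⊔-lub m≤x h≤x)) (ℕ.≤⇒≤ᵇ (ℕ.⊓-glb x≤l x≤cap)))
      (λ t → let
        u = ℕ.≤ᵇ⇒≤ (m ⊔ h) x (proj₁ (T-∧⁻ {m ⊔ h ≤ᵇ x} t))
        v = ℕ.≤ᵇ⇒≤ x (l ⊓ cap) (proj₂ (T-∧⁻ {m ⊔ h ≤ᵇ x} t)) in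
        T-∧⁺ (T-∧⁺ (ℕ.≤⇒≤ᵇ (ℕ.m≤n⊓o⇒m≤n l cap v)) (ℕ.≤⇒≤ᵇ (ℕ.m⊔n≤o⇒n≤o m h u)))
             (T-∧⁺ (ℕ.≤⇒≤ᵇ (ℕ.m≤n⊓o⇒m≤o l cap v)) (ℕ.≤⇒≤ᵇ (ℕ.m⊔n≤o⇒m≤o m h u))))

    term : ∀ x → blockStep p l x h * (⟦ x ≤ᵇ cap ⟧ * rise q x m) ≈
      k * (⟦ (m ⊔ h ≤ᵇ x) ∧ (x ≤ᵇ l ⊓ cap) ⟧ * (p ^ (l ⊓ cap ∸ x) * q ^ (x ∸ (m ⊔ h))))
    term x = begin
      (⟦ x ≤ᵇ l ⟧ * p ^ (l ∸ x)) * ⟦ h ≤ᵇ x ⟧ * (⟦ x ≤ᵇ cap ⟧ * (⟦ m ≤ᵇ x ⟧ * q ^ (x ∸ m)))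
        ≈⟨ solve 6 (λ u v w r s t → ((u ⊗ v) ⊗ w) ⊗ (r ⊗ (s ⊗ t)) ⊜ ((u ⊗ w) ⊗ (r ⊗ s)) ⊗ (v ⊗ t))
             refl _ _ _ _ _ _ ⟩
      ((⟦ x ≤ᵇ l ⟧ * ⟦ h ≤ᵇ x ⟧) * (⟦ x ≤ᵇ cap ⟧ * ⟦ m ≤ᵇ x ⟧)) * (p ^ (l ∸ x) * q ^ (x ∸ m))
        ≈⟨ *-congʳ (trans (⟦⟧-∧ ((x ≤ᵇ l) ∧ (h ≤ᵇ x)) _) (*-cong (⟦⟧-∧ (x ≤ᵇ l) _) (⟦⟧-∧ (x ≤ᵇ cap) _))) ⟨
      ⟦ ((x ≤ᵇ l) ∧ (h ≤ᵇ x)) ∧ ((x ≤ᵇ cap) ∧ (m ≤ᵇ x)) ⟧ * (p ^ (l ∸ x) * q ^ (x ∸ m))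
        ≈⟨ guard-≡ (guards x) (λ t → let (x≤l , h≤x) , (x≤cap , m≤x) = bounds t in *-cong
             (trans (^-congʳ p (≡.sym (m∸[m⊓n]+[m⊓n]∸k x≤l x≤cap))) (^-homo-* p (l ∸ cap) _))
             (trans (^-congʳ q (≡.sym (k∸m+x∸[m⊔k] m≤x h≤x))) (^-homo-* q (h ∸ m) _))) ⟩
      ⟦ (m ⊔ h ≤ᵇ x) ∧ (x ≤ᵇ l ⊓ cap) ⟧ *
        ((p ^ (l ∸ cap) * p ^ (l ⊓ cap ∸ x)) * (q ^ (h ∸ m) * q ^ (x ∸ (m ⊔ h))))
        ≈⟨ solve 5 (λ g u v r s → g ⊗ ((u ⊗ v) ⊗ (r ⊗ s)) ⊜ (u ⊗ r) ⊗ (g ⊗ (v ⊗ s))) refl _ _ _ _ _ ⟩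
      k * (⟦ (m ⊔ h ≤ᵇ x) ∧ (x ≤ᵇ l ⊓ cap) ⟧ * (p ^ (l ⊓ cap ∸ x) * q ^ (x ∸ (m ⊔ h)))) ∎

  -- The second strip requires the next intermediate row to be at most m. This is a cap m on the
  -- remaining rows, and the sum over the first row splits off.
  schur·capped-∷ : ∀ p q cap l (ls : Partition b) m ms →
    (schurKernel p · capped cap q) (l ∷ ls) (m ∷ ms) ≈
    rowSum p q (toℕ l) (head₀ ls) cap (toℕ m) * (schurKernel p · capped (toℕ m) q) ls ms
  schur·capped-∷ {b} p q cap l ls m ms = begin
    (schurKernel p · capped cap q) (l ∷ ls) (m ∷ ms)
      ≈⟨ ∑-partitions-∷ b _ ⟩
    ∑ entries (λ x → ∑ (partitions b) (λ xs →
      (blockStep p (toℕ l) (toℕ x) (head₀ ls) * schurKernel p ls xs) *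
      (⟦ toℕ x ≤ᵇ cap ⟧ * ((rise q (toℕ x) (toℕ m) * ⟦ head₀ xs ≤ᵇ toℕ m ⟧) * schurKernel q xs ms))))
      ≈⟨ ∑-cong entries (λ x → ∑-cong (partitions b) (λ xs →
           solve 6 (λ u v r s t w → (u ⊗ v) ⊗ (r ⊗ ((s ⊗ t) ⊗ w)) ⊜ (u ⊗ (r ⊗ s)) ⊗ (v ⊗ (t ⊗ w)))
             refl _ _ _ _ _ _)) ⟩
    ∑ entries (λ x → ∑ (partitions b) (λ xs →
      (blockStep p (toℕ l) (toℕ x) (head₀ ls) * (⟦ toℕ x ≤ᵇ cap ⟧ * rise q (toℕ x) (toℕ m))) *
      (schurKernel p ls xs * capped (toℕ m) q xs ms)))
      ≈⟨ ∑-*-∑ entries (partitions b) _ _ ⟩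
    rowSum p q (toℕ l) (head₀ ls) cap (toℕ m) * (schurKernel p · capped (toℕ m) q) ls ms ∎

  -- The prefactors make the induction on rows close: `q ^ (l ∸ cap)` joins the `p ^ (l ∸ cap)` of
  -- the row sum in a product symmetric in p and q, and the remaining `q ^ (h ∸ m)` is the prefactor
  -- of the tail under its cap m.
  schur·capped-comm : ∀ p q cap (l m : Partition b) →
    q ^ (head₀ l ∸ cap) * (schurKernel p · capped cap q) l m ≈
    p ^ (head₀ l ∸ cap) * (schurKernel q · capped cap p) l m
  schur·capped-comm p q cap [] [] = *-cong
    (trans (^-congʳ q (ℕ.0∸n≡0 cap)) (^-congʳ p (≡.sym (ℕ.0∸n≡0 cap)))) refl
  schur·capped-comm p q cap (l ∷ ls) (m ∷ ms) = begin
    α * (schurKernel p · capped cap q) (l ∷ ls) (m ∷ ms)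
      ≈⟨ *-congˡ (trans (schur·capped-∷ p q cap l ls m ms) (*-congʳ (rowSum≈intervalSum p q l′ h cap m′))) ⟩
    α * (((β * q ^ (h ∸ m′)) * S) * X)
      ≈⟨ solve 5 (λ u v w s t → u ⊗ (((v ⊗ w) ⊗ s) ⊗ t) ⊜ (u ⊗ (v ⊗ s)) ⊗ (w ⊗ t)) refl _ _ _ _ _ ⟩
    (α * (β * S)) * (q ^ (h ∸ m′) * X)
      ≈⟨ *-cong (*-congˡ (*-congˡ (intervalSum-comm a (m′ ⊔ h) (l′ ⊓ cap) p q
           (ℕ.≤-trans (ℕ.m⊓n≤m l′ cap) (toℕ≤pred[n] l)))))
           (schur·capped-comm p q m′ ls ms) ⟩
    (α * (β * S′)) * (p ^ (h ∸ m′) * Y)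
      ≈⟨ solve 5 (λ u v w s t → (u ⊗ (v ⊗ s)) ⊗ (w ⊗ t) ⊜ v ⊗ (((u ⊗ w) ⊗ s) ⊗ t)) refl _ _ _ _ _ ⟩
    β * (((α * p ^ (h ∸ m′)) * S′) * Y)
      ≈⟨ *-congˡ (trans (schur·capped-∷ q p cap l ls m ms) (*-congʳ (rowSum≈intervalSum q p l′ h cap m′))) ⟨
    β * (schurKernel q · capped cap p) (l ∷ ls) (m ∷ ms) ∎
    where
    l′ = toℕ l
    m′ = toℕ m
    h  = head₀ ls
    α  = q ^ (l′ ∸ cap)
    β  = p ^ (l′ ∸ cap)
    S  = intervalSum a (m′ ⊔ h) (l′ ⊓ cap) p q
    S′ = intervalSum a (m′ ⊔ h) (l′ ⊓ cap) q p
    X  = (schurKernel p · capped m′ q) ls ms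
    Y  = (schurKernel q · capped m′ p) ls ms

  -- Elegant fillings and the intertwining relation

  1^n≈1 : ∀ n → 1# ^ n ≈ 1#
  1^n≈1 zero    = refl
  1^n≈1 (suc n) = trans (*-identityˡ _) (1^n≈1 n)

  ∑-⟦≡⟧ : ∀ {n} (k : Fin n) (F : Fin n → Carrier) → ∑ (allFin n) (λ x → ⟦ toℕ x ≡ᵇ toℕ k ⟧ * F x) ≈ F k
  ∑-⟦≡⟧ {suc n} zero F = begin
    ∑ (allFin (suc n)) (λ x → ⟦ toℕ x ≡ᵇ 0 ⟧ * F x) ≡⟨ ∑-suc {n = n} _ ⟩
    1# * F zero ⊕ ∑ (allFin n) (λ x → 0# * F (suc x))
      ≈⟨ +-cong (*-identityˡ _) (∑-0 (allFin n) (λ _ → zeroˡ _)) ⟩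
    F zero ⊕ 0#                                     ≈⟨ +-identityʳ _ ⟩
    F zero                                          ∎
  ∑-⟦≡⟧ {suc n} (suc k) F = begin
    ∑ (allFin (suc n)) (λ x → ⟦ toℕ x ≡ᵇ suc (toℕ k) ⟧ * F x) ≡⟨ ∑-suc {n = n} _ ⟩
    0# * F zero ⊕ ∑ (allFin n) (λ x → ⟦ toℕ x ≡ᵇ toℕ k ⟧ * F (suc x))
      ≈⟨ +-cong (zeroˡ _) (∑-⟦≡⟧ k (F ∘ suc)) ⟩
    0# ⊕ F (suc k)                                            ≈⟨ +-identityˡ _ ⟩
    F (suc k)                                                 ∎

  ≡ᵇ-comm : ∀ m n → (m ≡ᵇ n) ≡ (n ≡ᵇ m)
  ≡ᵇ-comm m n = T-ext (λ t → ℕ.≡⇒≡ᵇ n m (≡.sym (ℕ.≡ᵇ⇒≡ m n t))) (λ t → ℕ.≡⇒≡ᵇ m n (≡.sym (ℕ.≡ᵇ⇒≡ n m t)))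

  ∑-⟦≡⟧′ : ∀ {n} (k : Fin n) (F : Fin n → Carrier) → ∑ (allFin n) (λ x → ⟦ toℕ k ≡ᵇ toℕ x ⟧ * F x) ≈ F k
  ∑-⟦≡⟧′ {n} k F = trans
    (∑-cong (allFin n) (λ x → *-congʳ (reflexive (≡.cong ⟦_⟧ (≡ᵇ-comm (toℕ k) (toℕ x)))))) (∑-⟦≡⟧ k F)

  δ : Kernel b
  δ []       []       = 1#
  δ (l ∷ ls) (m ∷ ms) = ⟦ toℕ l ≡ᵇ toℕ m ⟧ * δ ls ms

  ◁-δ : (u : Row b) → ∀ m → (u ◁ δ) m ≈ u m
  ◁-δ u [] = trans (+-identityʳ _) (*-identityʳ _)
  ◁-δ {suc b} u (m ∷ ms) = begin
    (u ◁ δ) (m ∷ ms)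
      ≈⟨ ∑-partitions-∷ b _ ⟩
    ∑ entries (λ x → ∑ (partitions b) (λ xs → u (x ∷ xs) * (⟦ toℕ x ≡ᵇ toℕ m ⟧ * δ xs ms)))
      ≈⟨ ∑-cong entries (λ x → trans (∑-cong (partitions b) (λ xs → x∙yz≈y∙xz _ _ _))
           (sym (*-∑ _ (partitions b) _))) ⟩
    ∑ entries (λ x → ⟦ toℕ x ≡ᵇ toℕ m ⟧ * ((λ xs → u (x ∷ xs)) ◁ δ) ms)
      ≈⟨ ∑-⟦≡⟧ m _ ⟩
    ((λ xs → u (m ∷ xs)) ◁ δ) ms
      ≈⟨ ◁-δ (λ xs → u (m ∷ xs)) ms ⟩
    u (m ∷ ms) ∎

  -- Generating kernel of elegant fillings, the transition matrix from Schur
  -- to dual Grothendieck polynomials: the first row is frozen, and the rows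
  -- beneath it gain one horizontal strip before they are themselves filled elegantly.
  elegant : Kernel b
  elegant {zero}  []       []       = 1#
  elegant {suc b} (l ∷ ls) (m ∷ ms) =
    ⟦ toℕ l ≡ᵇ toℕ m ⟧ * (elegant {b} · capped (toℕ m) 1#) ls ms

  -- The first row is frozen, so a weight that depends on its length can be moved across `elegant`.
  elegant-head : (l x : Partition b) (F : ℕ → Carrier) →
    elegant l x * F (head₀ l) ≈ elegant l x * F (head₀ x)
  elegant-head []       []       F = refl
  elegant-head (l ∷ ls) (x ∷ xs) F = trans (*-assoc _ _ _) (trans
    (guard (toℕ l ≡ᵇ toℕ x) (λ t → *-congˡ (reflexive (≡.cong F (ℕ.≡ᵇ⇒≡ (toℕ l) (toℕ x) t)))))
    (sym (*-assoc _ _ _)))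

  -- The power of q left over by the cap identity turns a pushing weight into a plain rise, since
  -- `m ⊔ k` exceeds m by `k ∸ m`. The guard `k ≤ l` survives as a cap on the rows beneath.
  pushStep-* : ∀ q l m k → pushStep q l m k * q ^ (k ∸ m) ≈ rise q l m * ⟦ k ≤ᵇ l ⟧
  pushStep-* q l m k = begin
    ⟦ (m ≤ᵇ l) ∧ (k ≤ᵇ l) ⟧ * q ^ (l ∸ (m ⊔ k)) * q ^ (k ∸ m)
      ≈⟨ *-assoc _ _ _ ⟩
    ⟦ (m ≤ᵇ l) ∧ (k ≤ᵇ l) ⟧ * (q ^ (l ∸ (m ⊔ k)) * q ^ (k ∸ m))
      ≈⟨ guard ((m ≤ᵇ l) ∧ (k ≤ᵇ l)) (λ t → let
           m≤l = ℕ.≤ᵇ⇒≤ m l (proj₁ (T-∧⁻ {m ≤ᵇ l} t))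
           k≤l = ℕ.≤ᵇ⇒≤ k l (proj₂ (T-∧⁻ {m ≤ᵇ l} t))
           in trans (*-comm _ _) (trans (sym (^-homo-* q (k ∸ m) _)) (^-congʳ q (k∸m+x∸[m⊔k] m≤l k≤l)))) ⟩
    ⟦ (m ≤ᵇ l) ∧ (k ≤ᵇ l) ⟧ * q ^ (l ∸ m)
      ≈⟨ *-congʳ (⟦⟧-∧ (m ≤ᵇ l) _) ⟩
    (⟦ m ≤ᵇ l ⟧ * ⟦ k ≤ᵇ l ⟧) * q ^ (l ∸ m)
      ≈⟨ solve 3 (λ u v w → (u ⊗ v) ⊗ w ⊜ (u ⊗ w) ⊗ v) refl _ _ _ ⟩
    rise q l m * ⟦ k ≤ᵇ l ⟧ ∎

  groth·elegant-∷ : ∀ q l (ls : Partition b) m ms →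
    (grothKernel q · elegant) (l ∷ ls) (m ∷ ms) ≈
    pushStep q (toℕ l) (toℕ m) (head₀ ls) * (grothKernel q · (elegant · capped (toℕ m) 1#)) ls ms
  groth·elegant-∷ {b} q l ls m ms = begin
    (grothKernel q · elegant) (l ∷ ls) (m ∷ ms)
      ≈⟨ ∑-partitions-∷ b _ ⟩
    ∑ entries (λ x → ∑ (partitions b) (λ xs →
      (pushStep q (toℕ l) (toℕ x) (head₀ ls) * grothKernel q ls xs) *
      (⟦ toℕ x ≡ᵇ toℕ m ⟧ * (elegant · capped (toℕ m) 1#) xs ms)))
      ≈⟨ ∑-cong entries (λ x → ∑-cong (partitions b) (λ xs →
           solve 4 (λ u v w s → (u ⊗ v) ⊗ (w ⊗ s) ⊜ (w ⊗ u) ⊗ (v ⊗ s)) refl _ _ _ _)) ⟩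
    ∑ entries (λ x → ∑ (partitions b) (λ xs →
      (⟦ toℕ x ≡ᵇ toℕ m ⟧ * pushStep q (toℕ l) (toℕ x) (head₀ ls)) *
      (grothKernel q ls xs * (elegant · capped (toℕ m) 1#) xs ms)))
      ≈⟨ ∑-*-∑ entries (partitions b) _ _ ⟩
    ∑ entries (λ x → ⟦ toℕ x ≡ᵇ toℕ m ⟧ * pushStep q (toℕ l) (toℕ x) (head₀ ls)) *
      (grothKernel q · (elegant · capped (toℕ m) 1#)) ls ms
      ≈⟨ *-congʳ (∑-⟦≡⟧ m _) ⟩
    pushStep q (toℕ l) (toℕ m) (head₀ ls) * (grothKernel q · (elegant · capped (toℕ m) 1#)) ls ms ∎

  -- Freezing forces the intermediate first row to be l. The rows beneath then carry two capped
  -- strips: that of the elegant filling under l, and that of weight q under m.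
  elegant·schur-∷ : ∀ q l (ls : Partition b) m ms →
    (elegant · schurKernel q) (l ∷ ls) (m ∷ ms) ≈
    rise q (toℕ l) (toℕ m) * (elegant · (capped (toℕ l) 1# · capped (toℕ m) q)) ls ms
  elegant·schur-∷ {b} q l ls m ms = begin
    (elegant · schurKernel q) (l ∷ ls) (m ∷ ms)
      ≈⟨ ∑-partitions-∷ b _ ⟩
    ∑ entries (λ x → ∑ (partitions b) (λ xs →
      (⟦ toℕ l ≡ᵇ toℕ x ⟧ * (elegant · capped (toℕ x) 1#) ls xs) *
      ((rise q (toℕ x) (toℕ m) * ⟦ head₀ xs ≤ᵇ toℕ m ⟧) * schurKernel q xs ms)))
      ≈⟨ ∑-cong entries (λ x → trans (∑-cong (partitions b) (λ xs →
           solve 5 (λ u v w s t → (u ⊗ v) ⊗ ((w ⊗ s) ⊗ t) ⊜ (u ⊗ w) ⊗ (v ⊗ (s ⊗ t))) refl _ _ _ _ _))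
           (trans (sym (*-∑ _ (partitions b) _)) (*-assoc _ _ _))) ⟩
    ∑ entries (λ x → ⟦ toℕ l ≡ᵇ toℕ x ⟧ *
      (rise q (toℕ x) (toℕ m) * (elegant · capped (toℕ x) 1# · capped (toℕ m) q) ls ms))
      ≈⟨ ∑-⟦≡⟧′ l _ ⟩
    rise q (toℕ l) (toℕ m) * (elegant · capped (toℕ l) 1# · capped (toℕ m) q) ls ms
      ≈⟨ *-congˡ (◁-assoc (elegant ls) (capped (toℕ l) 1#) (capped (toℕ m) q) ms) ⟩
    rise q (toℕ l) (toℕ m) * (elegant · (capped (toℕ l) 1# · capped (toℕ m) q)) ls ms ∎

  -- Once the first row is removed and the induction hypothesis applied, both sides are sums over
  -- the shape y that `elegant` produces from `ls`. They agree term by term.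
  groth·elegant≈elegant·schur : ∀ q (l m : Partition b) →
    (grothKernel q · elegant) l m ≈ (elegant · schurKernel q) l m
  groth·elegant≈elegant·schur q [] [] = refl
  groth·elegant≈elegant·schur {suc b} q (l ∷ ls) (m ∷ ms) = begin
    (grothKernel q · elegant) (l ∷ ls) (m ∷ ms)
      ≈⟨ groth·elegant-∷ q l ls m ms ⟩
    push (head₀ ls) * (grothKernel q · (elegant · C)) ls ms
      ≈⟨ *-congˡ (◁-assoc (grothKernel q ls) elegant C ms) ⟨
    push (head₀ ls) * (grothKernel q · elegant · C) ls ms
      ≈⟨ *-congˡ (◁-congˡ C (groth·elegant≈elegant·schur q ls) ms) ⟩
    push (head₀ ls) * (elegant · schurKernel q · C) ls ms
      ≈⟨ *-congˡ (◁-assoc (elegant ls) (schurKernel q) C ms) ⟩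
    push (head₀ ls) * (elegant · (schurKernel q · C)) ls ms
      ≈⟨ *-∑ _ (partitions b) _ ⟩
    ∑ (partitions b) (λ y → push (head₀ ls) * (elegant ls y * (schurKernel q · C) y ms))
      ≈⟨ ∑-cong (partitions b) term ⟩
    ∑ (partitions b) (λ y → rise q (toℕ l) (toℕ m) *
      (elegant ls y * (capped (toℕ l) 1# · capped (toℕ m) q) y ms))
      ≈⟨ *-∑ _ (partitions b) _ ⟨
    rise q (toℕ l) (toℕ m) * (elegant · (capped (toℕ l) 1# · capped (toℕ m) q)) ls ms
      ≈⟨ elegant·schur-∷ q l ls m ms ⟨
    (elegant · schurKernel q) (l ∷ ls) (m ∷ ms) ∎
    where
    C    = capped {b} (toℕ m) 1#
    push = pushStep q (toℕ l) (toℕ m)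

    -- The cap identity with weights q and 1: the power of `1#` disappears on one side and the power
    -- of q stays on the other.
    swap : ∀ y → (schurKernel q · C) y ms ≈
      q ^ (head₀ y ∸ toℕ m) * (schurKernel 1# · capped (toℕ m) q) y ms
    swap y = trans (sym (trans (*-congʳ (1^n≈1 (head₀ y ∸ toℕ m))) (*-identityˡ _)))
      (schur·capped-comm q 1# (toℕ m) y ms)

    term : ∀ y → push (head₀ ls) * (elegant ls y * (schurKernel q · C) y ms) ≈
      rise q (toℕ l) (toℕ m) * (elegant ls y * (capped (toℕ l) 1# · capped (toℕ m) q) y ms)
    term y = begin
      push (head₀ ls) * (elegant ls y * (schurKernel q · C) y ms)
        ≈⟨ solve 3 (λ u v w → u ⊗ (v ⊗ w) ⊜ (v ⊗ u) ⊗ w) refl _ _ _ ⟩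
      elegant ls y * push (head₀ ls) * (schurKernel q · C) y ms
        -- The pushing weight is now read at `head₀ y`, the length that occurs in the power of q
        -- from `swap`.
        ≈⟨ *-cong (elegant-head ls y push) (swap y) ⟩
      elegant ls y * push (head₀ y) * (q ^ (head₀ y ∸ toℕ m) * Z)
        ≈⟨ solve 4 (λ u v w s → (u ⊗ v) ⊗ (w ⊗ s) ⊜ u ⊗ ((v ⊗ w) ⊗ s)) refl _ _ _ _ ⟩
      elegant ls y * ((push (head₀ y) * q ^ (head₀ y ∸ toℕ m)) * Z)
        ≈⟨ *-congˡ (*-congʳ (pushStep-* q (toℕ l) (toℕ m) (head₀ y))) ⟩
      elegant ls y * ((rise q (toℕ l) (toℕ m) * ⟦ head₀ y ≤ᵇ toℕ l ⟧) * Z)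
        ≈⟨ solve 4 (λ u v w s → u ⊗ ((v ⊗ w) ⊗ s) ⊜ v ⊗ (u ⊗ (w ⊗ s))) refl _ _ _ _ ⟩
      rise q (toℕ l) (toℕ m) * (elegant ls y * (⟦ head₀ y ≤ᵇ toℕ l ⟧ * Z))
        ≈⟨ *-congˡ (*-congˡ (trans (*-∑ _ (partitions b) _) (∑-cong (partitions b) (λ _ → sym (*-assoc _ _ _))))) ⟩
      rise q (toℕ l) (toℕ m) * (elegant ls y * (capped (toℕ l) 1# · capped (toℕ m) q) y ms) ∎
      where Z = (schurKernel 1# · capped (toℕ m) q) y ms

  -- The empty partition, commutation and words in the kernels

  ∅ : Partition b
  ∅ = tabulateᵛ (λ _ → zero)

  -- Cap 0 empties the first row, and blocking hands the cap 0 on to the next row.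
  capped-∅ : (y : Partition b) → capped 0 1# y ∅ ≈ δ y ∅
  capped-∅ []            = *-identityˡ _
  capped-∅ (zero  ∷ ys)  = *-congˡ (trans (*-congʳ (trans (*-congʳ (*-identityˡ 1#)) (*-identityˡ _))) (capped-∅ ys))
  capped-∅ (suc y ∷ ys)  = trans (zeroˡ _) (sym (zeroˡ _))

  elegant-∅ : (x : Partition b) → elegant x ∅ ≈ δ x ∅
  elegant-∅ []       = refl
  elegant-∅ {suc b} (x ∷ xs) = *-congˡ (begin
    (elegant · capped 0 1#) xs ∅ ≈⟨ ∑-cong (partitions b) (λ y → *-congˡ (capped-∅ y)) ⟩
    (elegant · δ) xs ∅           ≈⟨ ◁-δ (elegant xs) ∅ ⟩
    elegant xs ∅                 ≈⟨ elegant-∅ xs ⟩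
    δ xs ∅                       ∎)

  ◁-elegant-∅ : (u : Row b) → (u ◁ elegant) ∅ ≈ u ∅
  ◁-elegant-∅ {b} u = trans (∑-cong (partitions b) (λ x → *-congˡ (elegant-∅ x))) (◁-δ u ∅)

  -- No row is longer than a, so the cap a always holds and both prefactors are 1.
  schur-comm : ∀ p q (l m : Partition b) →
    (schurKernel p · schurKernel q) l m ≈ (schurKernel q · schurKernel p) l m
  schur-comm {b} p q l m = begin
    (schurKernel p · schurKernel q) l m ≈⟨ uncap p q ⟨
    q ^ (head₀ l ∸ a) * (schurKernel p · capped a q) l m ≈⟨ schur·capped-comm p q a l m ⟩
    p ^ (head₀ l ∸ a) * (schurKernel q · capped a p) l m ≈⟨ uncap q p ⟩
    (schurKernel q · schurKernel p) l m ∎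
    where
    head₀≤a : ∀ {b} (x : Partition b) → head₀ x ≤ a
    head₀≤a []      = z≤n
    head₀≤a (x ∷ _) = toℕ≤pred[n] x

    uncap : ∀ p q → q ^ (head₀ l ∸ a) * (schurKernel p · capped a q) l m ≈ (schurKernel p · schurKernel q) l m
    uncap p q = trans
      (*-cong (^-congʳ q (ℕ.m≤n⇒m∸n≡0 (head₀≤a l)))
        (◁-congʳ (schurKernel p l) {L = schurKernel q} (λ x y → trans (*-congʳ (⟦⟧-T (ℕ.≤⇒≤ᵇ (head₀≤a x)))) (*-identityˡ _)) m))
      (*-identityˡ _)

  _◁[_]_ : Row b → (Carrier → Kernel b) → (Fin n → Carrier) → Row b
  _◁[_]_ {n = zero}  u K q = u
  _◁[_]_ {n = suc n} u K q = (u ◁ K (q zero)) ◁[ K ] (q ∘ suc)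

  ◁[]-cong : (K : Carrier → Kernel b) (q : Fin n → Carrier) {u v : Row b} →
    (∀ x → u x ≈ v x) → ∀ m → (u ◁[ K ] q) m ≈ (v ◁[ K ] q) m
  ◁[]-cong {n = zero}  K q u≈v = u≈v
  ◁[]-cong {n = suc n} K q u≈v = ◁[]-cong K (q ∘ suc) (◁-congˡ (K (q zero)) u≈v)

  ◁[]-≗ : (K : Carrier → Kernel b) {q q′ : Fin n → Carrier} (u : Row b) →
    (∀ i → q i ≡ q′ i) → u ◁[ K ] q ≡ u ◁[ K ] q′
  ◁[]-≗ {n = zero}  K u q≡q′ = ≡.refl
  ◁[]-≗ {n = suc n} K {q} {q′} u q≡q′ =
    ≡.trans (≡.cong (λ y → (u ◁ K y) ◁[ K ] (q ∘ suc)) (q≡q′ zero)) (◁[]-≗ K _ (q≡q′ ∘ suc))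

  ◁[]-intertwine : (K L : Carrier → Kernel b) (E : Kernel b) →
    (∀ y l m → (K y · E) l m ≈ (E · L y) l m) →
    (u : Row b) (q : Fin n → Carrier) → ∀ m → ((u ◁[ K ] q) ◁ E) m ≈ ((u ◁ E) ◁[ L ] q) m
  ◁[]-intertwine {n = zero}  K L E KE≈EL u q m = refl
  ◁[]-intertwine {n = suc n} K L E KE≈EL u q m = begin
    (((u ◁ K y) ◁[ K ] (q ∘ suc)) ◁ E) m ≈⟨ ◁[]-intertwine K L E KE≈EL (u ◁ K y) (q ∘ suc) m ⟩
    ((u ◁ K y ◁ E) ◁[ L ] (q ∘ suc)) m
      ≈⟨ ◁[]-cong L (q ∘ suc) (λ x → trans (◁-assoc u (K y) E x)
           (trans (◁-congʳ u (KE≈EL y) x) (sym (◁-assoc u E (L y) x)))) m ⟩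
    ((u ◁ E ◁ L y) ◁[ L ] (q ∘ suc)) m   ∎
    where y = q zero

  ◁[]-◁ : (u : Row b) (q : Fin n → Carrier) (y : Carrier) → ∀ m →
    ((u ◁[ schurKernel ] q) ◁ schurKernel y) m ≈ ((u ◁ schurKernel y) ◁[ schurKernel ] q) m
  ◁[]-◁ u q y = ◁[]-intertwine schurKernel schurKernel (schurKernel y) (λ z → schur-comm z y) u q

  -- Horizontal strips removed from the full rectangle

  full : Partition b
  full = tabulateᵛ (λ _ → fromℕ a)

  isFull : Row b
  isFull l = δ l full

  fillings : (b j : ℕ) → Row b
  fillings b j = isFull ◁[ schurKernel ] (λ (_ : Fin j) → 1#)

  -- Unfolding exposes the new strip next to the full rectangle, whereas the recursion on rows needs
  -- it last; commutation carries it there.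
  fillings-suc : ∀ b j m → fillings b (suc j) m ≈ (fillings b j ◁ schurKernel 1#) m
  fillings-suc b j m = sym (◁[]-◁ isFull (λ (_ : Fin j) → 1#) 1# m)

  -- A first row frozen at a can drop to any length s with weight 1, and s becomes the cap on the
  -- rows beneath. This is the shape of the recursion that defines `elegant`.
  fillings-step : (W : Row (suc b)) (w : Row b) →
    (∀ t ts → W (t ∷ ts) ≈ ⟦ toℕ t ≡ᵇ toℕ (fromℕ a) ⟧ * w ts) →
    ∀ s ss → (W ◁ schurKernel 1#) (s ∷ ss) ≈ (w ◁ capped (toℕ s) 1#) ss
  fillings-step {b} W w W≈w s ss = begin
    (W ◁ schurKernel 1#) (s ∷ ss)
      ≈⟨ ∑-partitions-∷ b _ ⟩
    ∑ entries (λ t → ∑ (partitions b) (λ ts → W (t ∷ ts) *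
      ((rise 1# (toℕ t) (toℕ s) * ⟦ head₀ ts ≤ᵇ toℕ s ⟧) * schurKernel 1# ts ss)))
      ≈⟨ ∑-cong entries (λ t → ∑-cong (partitions b) (λ ts → trans (*-congʳ (W≈w t ts))
           (solve 5 (λ u v r s t → (u ⊗ v) ⊗ ((r ⊗ s) ⊗ t) ⊜ (u ⊗ r) ⊗ (v ⊗ (s ⊗ t))) refl _ _ _ _ _))) ⟩
    ∑ entries (λ t → ∑ (partitions b) (λ ts → (⟦ toℕ t ≡ᵇ toℕ (fromℕ a) ⟧ * rise 1# (toℕ t) (toℕ s)) *
      (w ts * capped (toℕ s) 1# ts ss)))
      ≈⟨ ∑-*-∑ entries (partitions b) _ _ ⟩
    ∑ entries (λ t → ⟦ toℕ t ≡ᵇ toℕ (fromℕ a) ⟧ * rise 1# (toℕ t) (toℕ s)) * (w ◁ capped (toℕ s) 1#) ss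
      ≈⟨ *-congʳ (∑-⟦≡⟧ (fromℕ a) _) ⟩
    rise 1# (toℕ (fromℕ a)) (toℕ s) * (w ◁ capped (toℕ s) 1#) ss
      ≈⟨ *-congʳ (trans (*-congˡ (1^n≈1 (toℕ (fromℕ a) ∸ toℕ s))) (trans (*-identityʳ _) (⟦⟧-T (ℕ.≤⇒≤ᵇ s≤a)))) ⟩
    1# * (w ◁ capped (toℕ s) 1#) ss
      ≈⟨ *-identityˡ _ ⟩
    (w ◁ capped (toℕ s) 1#) ss ∎
    where
    s≤a : toℕ s ≤ toℕ (fromℕ a)
    s≤a = ≡.subst (toℕ s ≤_) (≡.sym (toℕ-fromℕ a)) (toℕ≤pred[n] s)

  -- Each horizontal strip removed from the full rectangle reaches one row higher.
  fillings-frozen : ∀ b j → j ≤ b → ∀ t ts →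
    fillings (suc b) j (t ∷ ts) ≈ ⟦ toℕ t ≡ᵇ toℕ (fromℕ a) ⟧ * fillings b j ts
  fillings-frozen b       zero    _         t ts = refl
  fillings-frozen (suc b) (suc j) (s≤s j≤b) t ts = begin
    fillings (suc (suc b)) (suc j) (t ∷ ts)
      ≈⟨ fillings-suc (suc (suc b)) j (t ∷ ts) ⟩
    (fillings (suc (suc b)) j ◁ schurKernel 1#) (t ∷ ts)
      ≈⟨ fillings-step _ _ (fillings-frozen (suc b) j (ℕ.m≤n⇒m≤1+n j≤b)) t ts ⟩
    (fillings (suc b) j ◁ capped (toℕ t) 1#) ts
      ≈⟨ ∑-cong (partitions (suc b)) (λ { (y ∷ ys) → pull y ys }) ⟩
    ∑ (partitions (suc b)) (λ x → ⟦ toℕ t ≡ᵇ a′ ⟧ * (fillings (suc b) j x * schurKernel 1# x ts))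
      ≈⟨ *-∑ _ (partitions (suc b)) _ ⟨
    ⟦ toℕ t ≡ᵇ a′ ⟧ * (fillings (suc b) j ◁ schurKernel 1#) ts
      ≈⟨ *-congˡ (fillings-suc (suc b) j ts) ⟨
    ⟦ toℕ t ≡ᵇ a′ ⟧ * fillings (suc b) (suc j) ts ∎
    where
    a′ = toℕ (fromℕ a)

    a≤t≡t≡a : (a′ ≤ᵇ toℕ t) ≡ (toℕ t ≡ᵇ a′)
    a≤t≡t≡a = T-ext
      (λ u → ℕ.≡⇒≡ᵇ _ _ (ℕ.≤-antisym
        (≡.subst (toℕ t ≤_) (≡.sym (toℕ-fromℕ a)) (toℕ≤pred[n] t)) (ℕ.≤ᵇ⇒≤ a′ _ u)))
      (λ u → ℕ.≤⇒≤ᵇ (ℕ.≤-reflexive (≡.sym (ℕ.≡ᵇ⇒≡ (toℕ t) a′ u))))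

    -- The second row is still y = a and the cap bounds it by t, so the cap is the condition t = a.
    pull : ∀ y ys → fillings (suc b) j (y ∷ ys) * (⟦ toℕ y ≤ᵇ toℕ t ⟧ * schurKernel 1# (y ∷ ys) ts) ≈
      ⟦ toℕ t ≡ᵇ a′ ⟧ * (fillings (suc b) j (y ∷ ys) * schurKernel 1# (y ∷ ys) ts)
    pull y ys = begin
      fillings (suc b) j (y ∷ ys) * (⟦ toℕ y ≤ᵇ toℕ t ⟧ * h)
        ≈⟨ *-congʳ (fillings-frozen b j j≤b y ys) ⟩
      (⟦ toℕ y ≡ᵇ a′ ⟧ * z) * (⟦ toℕ y ≤ᵇ toℕ t ⟧ * h)
        ≈⟨ solve 4 (λ u v r s → (u ⊗ v) ⊗ (r ⊗ s) ⊜ (u ⊗ r) ⊗ (v ⊗ s)) refl _ _ _ _ ⟩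
      (⟦ toℕ y ≡ᵇ a′ ⟧ * ⟦ toℕ y ≤ᵇ toℕ t ⟧) * (z * h)
        ≈⟨ *-congʳ (guard (toℕ y ≡ᵇ a′) (λ u → reflexive (≡.cong ⟦_⟧
             (≡.trans (≡.cong (_≤ᵇ toℕ t) (ℕ.≡ᵇ⇒≡ (toℕ y) a′ u)) a≤t≡t≡a)))) ⟩
      (⟦ toℕ y ≡ᵇ a′ ⟧ * ⟦ toℕ t ≡ᵇ a′ ⟧) * (z * h)
        ≈⟨ solve 4 (λ u v r s → (u ⊗ v) ⊗ (r ⊗ s) ⊜ v ⊗ ((u ⊗ r) ⊗ s)) refl _ _ _ _ ⟩
      ⟦ toℕ t ≡ᵇ a′ ⟧ * ((⟦ toℕ y ≡ᵇ a′ ⟧ * z) * h)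
        ≈⟨ *-congˡ (*-congʳ (fillings-frozen b j j≤b y ys)) ⟨
      ⟦ toℕ t ≡ᵇ a′ ⟧ * (fillings (suc b) j (y ∷ ys) * h) ∎
      where
      z = fillings b j ys
      h = schurKernel 1# (y ∷ ys) ts

  allOnes : Row b
  allOnes _ = 1#

  allOnes◁elegant : ∀ b m → (allOnes ◁ elegant) m ≈ fillings b b m
  allOnes◁elegant zero    []       = trans (+-identityʳ _) (*-identityˡ _)
  allOnes◁elegant (suc b) (m ∷ ms) = begin
    (allOnes ◁ elegant) (m ∷ ms)
      ≈⟨ ∑-partitions-∷ b _ ⟩
    ∑ entries (λ x → ∑ (partitions b) (λ xs →
      1# * (⟦ toℕ x ≡ᵇ toℕ m ⟧ * (elegant · capped (toℕ m) 1#) xs ms)))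
      ≈⟨ ∑-cong entries (λ x → ∑-cong (partitions b) (λ xs →
           solve 2 (λ u v → 𝟏 ⊗ (u ⊗ v) ⊜ (u ⊗ 𝟏) ⊗ (𝟏 ⊗ v)) refl _ _)) ⟩
    ∑ entries (λ x → ∑ (partitions b) (λ xs →
      (⟦ toℕ x ≡ᵇ toℕ m ⟧ * 1#) * (1# * (elegant · capped (toℕ m) 1#) xs ms)))
      ≈⟨ ∑-*-∑ entries (partitions b) _ _ ⟩
    ∑ entries (λ x → ⟦ toℕ x ≡ᵇ toℕ m ⟧ * 1#) * (allOnes ◁ (elegant · capped (toℕ m) 1#)) ms
      ≈⟨ trans (*-congʳ (∑-⟦≡⟧ m _)) (*-identityˡ _) ⟩
    (allOnes ◁ (elegant · capped (toℕ m) 1#)) ms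
      ≈⟨ ◁-assoc allOnes elegant (capped (toℕ m) 1#) ms ⟨
    (allOnes ◁ elegant ◁ capped (toℕ m) 1#) ms
      ≈⟨ ◁-congˡ (capped (toℕ m) 1#) (allOnes◁elegant b) ms ⟩
    (fillings b b ◁ capped (toℕ m) 1#) ms
      ≈⟨ fillings-step _ _ (fillings-frozen b b ℕ.≤-refl) m ms ⟨
    (fillings (suc b) b ◁ schurKernel 1#) (m ∷ ms)
      ≈⟨ fillings-suc (suc b) b (m ∷ ms) ⟨
    fillings (suc b) (suc b) (m ∷ ms) ∎

  ◁[]-onesThen : ∀ (K : Carrier → Kernel b) k c (q : Fin c → Carrier) (u : Row b) →
    u ◁[ K ] onesThen R k c q ≡ (u ◁[ K ] (λ (_ : Fin k) → 1#)) ◁[ K ] q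
  ◁[]-onesThen K zero    c q u = ≡.refl
  ◁[]-onesThen K (suc k) c q u = ≡.trans (◁[]-≗ K _ tail) (◁[]-onesThen K k c q _)
    where
    tail : ∀ i → onesThen R (suc k) c q (suc i) ≡ onesThen R k c q i
    tail i with splitAt k i
    ... | inj₁ _ = ≡.refl
    ... | inj₂ _ = ≡.refl

  groth≈schur : ∀ b c (q : Fin c → Carrier) →
    (allOnes {b} ◁[ grothKernel ] q) ∅ ≈ (isFull ◁[ schurKernel ] onesThen R b c q) ∅
  groth≈schur b c q = begin
    (allOnes {b} ◁[ grothKernel ] q) ∅             ≈⟨ ◁-elegant-∅ (allOnes {b} ◁[ grothKernel ] q) ⟨
    ((allOnes ◁[ grothKernel ] q) ◁ E) ∅
      ≈⟨ ◁[]-intertwine {b} grothKernel schurKernel E groth·elegant≈elegant·schur (allOnes {b}) q ∅ ⟩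
    ((allOnes ◁ E) ◁[ schurKernel ] q) ∅       ≈⟨ ◁[]-cong schurKernel q (allOnes◁elegant b) ∅ ⟩
    (fillings b b ◁[ schurKernel ] q) ∅        ≡⟨ ≡.cong (λ f → f ∅) (◁[]-onesThen schurKernel b c q isFull) ⟨
    (isFull ◁[ schurKernel ] onesThen R b c q) ∅ ∎
    where
    E : Kernel b
    E = elegant

  -- Sums over chains as entries of kernel products

  zeros tops : Fin b → Fin (suc a)
  zeros _ = zero
  tops  _ = fromℕ a

  -- Transfer matrices: summing over the first shape absorbs one kernel into the row u, which is why
  -- u is arbitrary.
  ∑-chains : (K : Carrier → Kernel b) → ∀ m (q : Fin m → Carrier) (u : Row b) →
    ∑ (allArrays m b entries) (λ L → u (tabulateᵛ (headOr zeros L)) *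
      ∏ (allFin m) (λ k → K (q k) (tabulateᵛ (L k)) (tabulateᵛ (next zeros L k)))) ≈
    (u ◁[ K ] q) ∅
  ∑-chains     K zero    q u = trans (+-identityʳ _) (*-identityʳ _)
  ∑-chains {b} K (suc m) q u = begin
    ∑ (allArrays (suc m) b entries) _
      ≈⟨ ∑-allFuns m rows _ ⟩
    ∑ rows (λ s → ∑ (allFuns m rows) (λ L → u (tabulateᵛ s) * ∏ (allFin (suc m)) (λ k →
      K (q k) (tabulateᵛ ((s ∷ᶠ L) k)) (tabulateᵛ (next zeros (s ∷ᶠ L) k)))))
      ≈⟨ ∑-cong rows (λ s → ∑-cong (allFuns m rows) (λ L → trans
           (*-congˡ (reflexive (∏-suc (λ k → K (q k) (tabulateᵛ ((s ∷ᶠ L) k)) (tabulateᵛ (next zeros (s ∷ᶠ L) k))))))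
           (sym (*-assoc _ _ _)))) ⟩
    ∑ rows (λ s → ∑ (allFuns m rows) (λ L →
      (u (tabulateᵛ s) * K (q zero) (tabulateᵛ s) (tabulateᵛ (headOr zeros L))) * rest L))
      ≈⟨ ∑-comm rows (allFuns m rows) _ ⟩
    ∑ (allFuns m rows) (λ L → ∑ rows (λ s →
      (u (tabulateᵛ s) * K (q zero) (tabulateᵛ s) (tabulateᵛ (headOr zeros L))) * rest L))
      ≈⟨ ∑-cong (allFuns m rows) (λ L → trans (sym (∑-* (rest L) rows _))
           (*-congʳ (sym (reflexive (∑-partitions b _))))) ⟩
    ∑ (allFuns m rows) (λ L → (u ◁ K (q zero)) (tabulateᵛ (headOr zeros L)) * rest L)
      ≈⟨ ∑-chains K m (q ∘ suc) (u ◁ K (q zero)) ⟩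
    (u ◁[ K ] q) ∅ ∎
    where
    rows = allFuns b entries

    rest : (Fin m → Fin b → Fin (suc a)) → Carrier
    rest L = ∏ (allFin m) (λ k → K (q (suc k)) (tabulateᵛ (L k)) (tabulateᵛ (next zeros L k)))

  -- The bottom shape p is general so that strips can be peeled off from below. There is one strip
  -- more than there are intermediate shapes, because the top is fixed at the full rectangle.
  ∑-schurChains : ∀ m (x : Fin (suc m) → Carrier) (p : Fin b → Fin (suc a)) →
    ∑ (allArrays m b entries) (λ L → ∏ (allFin (suc m)) (λ w →
      schurKernel (x w) (tabulateᵛ (next tops (p ∷ᶠ L) w)) (tabulateᵛ ((p ∷ᶠ L) w)))) ≈
    (isFull ◁[ schurKernel ] x) (tabulateᵛ p)
  ∑-schurChains {b} zero x p = begin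
    schurKernel (x zero) full (tabulateᵛ p) * 1# ⊕ 0#      ≈⟨ trans (+-identityʳ _) (*-identityʳ _) ⟩
    schurKernel (x zero) full (tabulateᵛ p)                ≈⟨ ◁-δ (λ l → schurKernel (x zero) l (tabulateᵛ p)) full ⟨
    ((λ l → schurKernel (x zero) l (tabulateᵛ p)) ◁ δ) full ≈⟨ ∑-cong (partitions b) (λ l → *-comm _ _) ⟩
    (isFull ◁ schurKernel (x zero)) (tabulateᵛ p)          ∎
  ∑-schurChains {b} (suc m) x p = begin
    ∑ (allArrays (suc m) b entries) _
      ≈⟨ ∑-allFuns m rows _ ⟩
    ∑ rows (λ s → ∑ (allFuns m rows) (λ L → ∏ (allFin (suc (suc m))) (λ w →
      schurKernel (x w) (tabulateᵛ (next tops (p ∷ᶠ (s ∷ᶠ L)) w)) (tabulateᵛ ((p ∷ᶠ (s ∷ᶠ L)) w)))))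
      ≈⟨ ∑-cong rows (λ s → trans (∑-cong (allFuns m rows) (λ L → reflexive
           (∏-suc (λ w → schurKernel (x w) (tabulateᵛ (next tops (p ∷ᶠ (s ∷ᶠ L)) w)) (tabulateᵛ ((p ∷ᶠ (s ∷ᶠ L)) w))))))
           (sym (*-∑ _ (allFuns m rows) _))) ⟩
    ∑ rows (λ s → schurKernel (x zero) (tabulateᵛ s) (tabulateᵛ p) *
      ∑ (allFuns m rows) (λ L → ∏ (allFin (suc m)) (λ w →
        schurKernel (x (suc w)) (tabulateᵛ (next tops (s ∷ᶠ L) w)) (tabulateᵛ ((s ∷ᶠ L) w)))))
      ≈⟨ ∑-cong rows (λ s → trans (*-congˡ (∑-schurChains m (x ∘ suc) s)) (*-comm _ _)) ⟩
    ∑ rows (λ s → (isFull ◁[ schurKernel ] (x ∘ suc)) (tabulateᵛ s) * schurKernel (x zero) (tabulateᵛ s) (tabulateᵛ p))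
      ≡⟨ ∑-partitions b _ ⟨
    ((isFull ◁[ schurKernel ] (x ∘ suc)) ◁ schurKernel (x zero)) (tabulateᵛ p)
      -- The smallest letter fills the strip next to p, while the word puts its first variable next
      -- to the full rectangle; commutation reverses the order.
      ≈⟨ ◁[]-◁ isFull (x ∘ suc) (x zero) (tabulateᵛ p) ⟩
    (isFull ◁[ schurKernel ] x) (tabulateᵛ p) ∎
    where rows = allFuns b entries

  head₀-tabulate : (f : Fin b → Fin (suc a)) → head₀ (tabulateᵛ f) ≡ headOr 0 (toℕ ∘ f)
  head₀-tabulate {zero}  f = ≡.refl
  head₀-tabulate {suc b} f = ≡.refl

  schurKernel-tabulate : ∀ y (l m : Fin b → Fin (suc a)) →
    schurKernel y (tabulateᵛ l) (tabulateᵛ m) ≈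
    ∏ (allFin b) (λ i → ⟦ (toℕ (m i) ≤ᵇ toℕ (l i)) ∧ (next 0 (toℕ ∘ l) i ≤ᵇ toℕ (m i)) ⟧ *
                        y ^ (toℕ (l i) ∸ toℕ (m i)))
  schurKernel-tabulate {zero}  y l m = refl
  schurKernel-tabulate {suc b} y l m = trans
    (*-cong (begin
      (⟦ toℕ (m zero) ≤ᵇ toℕ (l zero) ⟧ * y ^ (toℕ (l zero) ∸ toℕ (m zero))) *
        ⟦ head₀ (tabulateᵛ (l ∘ suc)) ≤ᵇ toℕ (m zero) ⟧
        ≈⟨ *-congˡ (reflexive (≡.cong (λ h → ⟦ h ≤ᵇ toℕ (m zero) ⟧) (head₀-tabulate (l ∘ suc)))) ⟩
      (⟦ toℕ (m zero) ≤ᵇ toℕ (l zero) ⟧ * y ^ (toℕ (l zero) ∸ toℕ (m zero))) *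
        ⟦ next 0 (toℕ ∘ l) zero ≤ᵇ toℕ (m zero) ⟧
        ≈⟨ solve 3 (λ u v w → (u ⊗ v) ⊗ w ⊜ (u ⊗ w) ⊗ v) refl _ _ _ ⟩
      (⟦ toℕ (m zero) ≤ᵇ toℕ (l zero) ⟧ * ⟦ next 0 (toℕ ∘ l) zero ≤ᵇ toℕ (m zero) ⟧) *
        y ^ (toℕ (l zero) ∸ toℕ (m zero))
        ≈⟨ *-congʳ (⟦⟧-∧ (toℕ (m zero) ≤ᵇ toℕ (l zero)) _) ⟨
      ⟦ (toℕ (m zero) ≤ᵇ toℕ (l zero)) ∧ (next 0 (toℕ ∘ l) zero ≤ᵇ toℕ (m zero)) ⟧ *
        y ^ (toℕ (l zero) ∸ toℕ (m zero)) ∎)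
      (schurKernel-tabulate y (l ∘ suc) (m ∘ suc)))
    (reflexive (≡.sym (∏-suc {n = b} _)))

  grothKernel-tabulate : ∀ y (l m : Fin b → Fin (suc a)) →
    grothKernel y (tabulateᵛ l) (tabulateᵛ m) ≈
    ∏ (allFin b) (λ i → pushStep y (toℕ (l i)) (toℕ (m i)) (next 0 (toℕ ∘ l) i))
  grothKernel-tabulate {zero}  y l m = refl
  grothKernel-tabulate {suc b} y l m = trans
    (*-cong (reflexive (≡.cong (pushStep y (toℕ (l zero)) (toℕ (m zero))) (head₀-tabulate (l ∘ suc))))
      (grothKernel-tabulate y (l ∘ suc) (m ∘ suc)))
    (reflexive (≡.sym (∏-suc {n = b} _)))

-- Arrays and their level sets

infix 4 _⇔ᵇ_

_⇔ᵇ_ : Bool → Bool → Bool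
true  ⇔ᵇ y = y
false ⇔ᵇ y = not y

⇔ᵇ⇒≡ : ∀ x y → T (x ⇔ᵇ y) → x ≡ y
⇔ᵇ⇒≡ true  true  _ = ≡.refl
⇔ᵇ⇒≡ false false _ = ≡.refl

⇔ᵇ-comm : ∀ x y → (x ⇔ᵇ y) ≡ (y ⇔ᵇ x)
⇔ᵇ-comm true  true  = ≡.refl
⇔ᵇ-comm true  false = ≡.refl
⇔ᵇ-comm false true  = ≡.refl
⇔ᵇ-comm false false = ≡.refl

⇔ᵇ-not-comm : ∀ x y → (x ⇔ᵇ not y) ≡ (y ⇔ᵇ not x)
⇔ᵇ-not-comm true  true  = ≡.refl
⇔ᵇ-not-comm true  false = ≡.refl
⇔ᵇ-not-comm false true  = ≡.refl
⇔ᵇ-not-comm false false = ≡.refl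

T-not : ∀ {x y} → (T y → T x) → T (not x) → T (not y)
T-not {false} {true}  f _ = f tt
T-not {_}     {false} f _ = tt

Antitone : (Fin n → Bool) → Set
Antitone u = ∀ {i j} → toℕ i ≤ toℕ j → T (u j) → T (u i)

-- ν is the identity for plane partitions and the negation for tableaux, whose rows increase.
Compatible : (Bool → Bool) → Array b a (Fin (suc m)) → Array m b (Fin (suc a)) → Set
Compatible ν π L = ∀ k i j → (toℕ k <ᵇ toℕ (π i j)) ≡ ν (toℕ j <ᵇ toℕ (L k i))

module LevelSets {c ℓ₀ : Level} (R : CommutativeRing c ℓ₀) (ν : Bool → Bool)
  (ν-swap : ∀ x y → (x ⇔ᵇ ν y) ≡ (y ⇔ᵇ ν x)) (a b m : ℕ) where
  open CommutativeRing R hiding (_+_; zero)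
  open CommutativeRing R using () renaming (_+_ to _⊕_)
  open RingSums R
  open SetoidReasoning setoid

  -- An antitone Boolean sequence is true exactly on an initial segment, so one length l matches it.
  -- The induction splits on `u zero`: if false, antitonicity makes all of u false and only l = 0
  -- fits; if true, l is a successor.
  ∑-threshold : ∀ n (u : Fin n → Bool) → Antitone u →
    ∑ (allFin (suc n)) (λ l → ∏ (allFin n) (λ j → ⟦ (toℕ j <ᵇ toℕ l) ⇔ᵇ u j ⟧)) ≈ 1#
  ∑-threshold zero    u anti = +-identityʳ 1#
  ∑-threshold (suc n) u anti = begin
    ∑ (allFin (suc (suc n))) (λ l → ∏ (allFin (suc n)) (λ j → ⟦ (toℕ j <ᵇ toℕ l) ⇔ᵇ u j ⟧))
      ≡⟨ ∑-suc {n = suc n} _ ⟩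
    ∏ (allFin (suc n)) (λ j → ⟦ not (u j) ⟧) ⊕
      ∑ (allFin (suc n)) (λ l → ∏ (allFin (suc n)) (λ j → ⟦ (toℕ j <ᵇ suc (toℕ l)) ⇔ᵇ u j ⟧))
      ≈⟨ +-cong (trans (∏-⟦⟧ (not ∘ u)) (reflexive (≡.cong ⟦_⟧ allFalse)))
           (∑-cong (allFin (suc n)) (λ l → reflexive (∏-suc {n = n} _))) ⟩
    ⟦ not (u zero) ⟧ ⊕
      ∑ (allFin (suc n)) (λ l → ⟦ u zero ⟧ * ∏ (allFin n) (λ j → ⟦ (toℕ j <ᵇ toℕ l) ⇔ᵇ u (suc j) ⟧))
      ≈⟨ +-congˡ (*-∑ _ (allFin (suc n)) _) ⟨
    ⟦ not (u zero) ⟧ ⊕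
      ⟦ u zero ⟧ * ∑ (allFin (suc n)) (λ l → ∏ (allFin n) (λ j → ⟦ (toℕ j <ᵇ toℕ l) ⇔ᵇ u (suc j) ⟧))
      ≈⟨ +-congˡ (trans (*-congˡ (∑-threshold n (u ∘ suc) (λ i≤j → anti (s≤s i≤j)))) (*-identityʳ _)) ⟩
    ⟦ not (u zero) ⟧ ⊕ ⟦ u zero ⟧
      ≈⟨ excludedMiddle (u zero) ⟩
    1# ∎
    where
    excludedMiddle : ∀ x → ⟦ not x ⟧ ⊕ ⟦ x ⟧ ≈ 1#
    excludedMiddle true  = +-identityˡ 1#
    excludedMiddle false = +-identityʳ 1#

    allFalse : ∀ᵇ (suc n) (not ∘ u) ≡ not (u zero)
    allFalse = T-ext (λ t → ∀ᵇ⁻ (not ∘ u) t zero)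
      (λ t → ∀ᵇ⁺ (not ∘ u) (λ j → T-not {u zero} (anti {zero} {j} z≤n) t))

  arrays : List (Array b a (Fin (suc m)))
  arrays = allArrays b a (allFin (suc m))

  levels : List (Array m b (Fin (suc a)))
  levels = allArrays m b (allFin (suc a))

  private
    agree : Array b a (Fin (suc m)) → Array m b (Fin (suc a)) → Fin m → Fin b → Fin a → Bool
    agree π L k i j = (toℕ k <ᵇ toℕ (π i j)) ⇔ᵇ ν (toℕ j <ᵇ toℕ (L k i))

    -- The indicator of `Compatible`. Summing over this relation replaces an explicit bijection, so
    -- neither inverse maps nor equality of arrays as functions enter.
    coupling : Array b a (Fin (suc m)) → Array m b (Fin (suc a)) → Carrier
    coupling π L = ∏ (allFin m) (λ k → ∏ (allFin b) (λ i → ∏ (allFin a) (λ j → ⟦ agree π L k i j ⟧)))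

    -- Each factor of the coupling for fixed (k, i) involves the single number L k i, so the sum
    -- factors and `∑-threshold` applies to each piece; `ν-swap` moves ν onto the side that is
    -- fixed.
    ∑-levels : ∀ π → (∀ k i → Antitone (λ j → ν (toℕ k <ᵇ toℕ (π i j)))) → ∑ levels (coupling π) ≈ 1#
    ∑-levels π anti = trans
      (∑-∏∏ m b (allFin (suc a)) (λ k i l → ∏ (allFin a) (λ j → ⟦ (toℕ k <ᵇ toℕ (π i j)) ⇔ᵇ ν (toℕ j <ᵇ toℕ l) ⟧)))
      (∏-1 (allFin m) (λ k → ∏-1 (allFin b) (λ i → trans
        (∑-cong (allFin (suc a)) (λ l → ∏-cong (allFin a) (λ j →
          reflexive (≡.cong ⟦_⟧ (ν-swap (toℕ k <ᵇ toℕ (π i j)) (toℕ j <ᵇ toℕ l))))))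
        (∑-threshold a _ (anti k i)))))

    ∑-arrays : ∀ L → (∀ i j → Antitone (λ k → ν (toℕ j <ᵇ toℕ (L k i)))) →
      ∑ arrays (λ π → coupling π L) ≈ 1#
    ∑-arrays L anti = trans
      (∑-cong arrays (λ π → trans (∏-comm (allFin m) (allFin b) _)
        (∏-cong (allFin b) (λ i → ∏-comm (allFin m) (allFin a) (λ k j → ⟦ agree π L k i j ⟧)))))
      (trans (∑-∏∏ b a (allFin (suc m)) (λ i j p → ∏ (allFin m) (λ k → ⟦ (toℕ k <ᵇ toℕ p) ⇔ᵇ ν (toℕ j <ᵇ toℕ (L k i)) ⟧)))
        (∏-1 (allFin b) (λ i → ∏-1 (allFin a) (λ j → ∑-threshold m _ (anti i j)))))

    coupling-support : ∀ π L {u v} → (Compatible ν π L → u ≈ v) → u * coupling π L ≈ v * coupling π L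
    coupling-support π L {u} {v} u≈v = begin
      u * coupling π L ≈⟨ *-congˡ coupling≈⟦⟧ ⟩
      u * ⟦ t ⟧        ≈⟨ *-comm _ _ ⟩
      ⟦ t ⟧ * u        ≈⟨ guard t (λ p → u≈v (λ k i j →
        ⇔ᵇ⇒≡ _ _ (∀ᵇ⁻ (agree π L k i) (∀ᵇ⁻ (λ i → ∀ᵇ a (agree π L k i)) (∀ᵇ⁻ _ p k) i) j))) ⟩
      ⟦ t ⟧ * v        ≈⟨ *-comm _ _ ⟩
      v * ⟦ t ⟧        ≈⟨ *-congˡ coupling≈⟦⟧ ⟨
      v * coupling π L ∎
      where
      t = ∀ᵇ m (λ k → ∀ᵇ b (λ i → ∀ᵇ a (agree π L k i)))

      coupling≈⟦⟧ : coupling π L ≈ ⟦ t ⟧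
      coupling≈⟦⟧ = trans
        (∏-cong (allFin m) (λ k → trans (∏-cong (allFin b) (λ i → ∏-⟦⟧ (agree π L k i))) (∏-⟦⟧ {n = b} _)))
        (∏-⟦⟧ {n = m} _)

  ∑-arrays≈∑-levels : (f : Array b a (Fin (suc m)) → Carrier) (g : Array m b (Fin (suc a)) → Carrier) →
    (∀ π → f π ≈ 0# ⊎ (∀ k i → Antitone (λ j → ν (toℕ k <ᵇ toℕ (π i j))))) →
    (∀ L → g L ≈ 0# ⊎ (∀ i j → Antitone (λ k → ν (toℕ j <ᵇ toℕ (L k i))))) →
    (∀ π L → Compatible ν π L → f π ≈ g L) →
    ∑ arrays f ≈ ∑ levels g
  ∑-arrays≈∑-levels f g f-anti g-anti f≈g = ∑-coupling arrays levels f g coupling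
    (λ π → [ inj₁ , inj₂ ∘ ∑-levels π ]′ (f-anti π))
    (λ L → [ inj₁ , inj₂ ∘ ∑-arrays L ]′ (g-anti L))
    (λ π L → coupling-support π L (f≈g π L))

-- Comparing neighbours, and numbers through their initial segments

next-rel : (P : ℕ → A → B → Set) (f : Fin n → A) (g : Fin n → B) {d : A} {e : B} →
  (∀ i → P (toℕ i) (f i) (g i)) → P n d e → ∀ i → P (suc (toℕ i)) (next d f i) (next e g i)
next-rel {n = suc zero}    P f g Pfg Pde zero    = Pde
next-rel {n = suc (suc n)} P f g Pfg Pde zero    = Pfg (suc zero)
next-rel {n = suc n}       P f g Pfg Pde (suc i) =
  next-rel (P ∘ suc) (f ∘ suc) (g ∘ suc) (Pfg ∘ suc) Pde i

next-suc : (d : A) (f : Fin n → A) (i j : Fin n) → toℕ j ≡ suc (toℕ i) → next d f i ≡ f j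
next-suc {n = suc (suc n)} d f zero    (suc zero) eq = ≡.refl
next-suc {n = suc n}       d f (suc i) (suc j)    eq = next-suc d (f ∘ suc) i j (ℕ.suc-injective eq)

next-last : (d : A) (f : Fin n → A) (i : Fin n) → n ≤ suc (toℕ i) → next d f i ≡ d
next-last {n = suc zero}    d f zero    n≤1 = ≡.refl
next-last {n = suc (suc n)} d f zero    (s≤s ())
next-last {n = suc n}       d f (suc i) (s≤s n≤i) = next-last d (f ∘ suc) i n≤i

next-elim : (Q : A → Set) (d : A) (f : Fin n → A) (i : Fin n) →
  Q d → (∀ j → toℕ j ≡ suc (toℕ i) → Q (f j)) → Q (next d f i)
next-elim {n = n} Q d f i Qd Qf with suc (toℕ i) <? n
... | yes p = ≡.subst Q (≡.sym (next-suc d f i (fromℕ< p) (toℕ-fromℕ< p))) (Qf (fromℕ< p) (toℕ-fromℕ< p))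
... | no ¬p = ≡.subst Q (≡.sym (next-last d f i (ℕ.≮⇒≥ ¬p))) Qd

-- Transitivity is all that is assumed, so this also serves the strict order along the columns of a
-- tableau.
steps⇒related : (_∼_ : A → A → Set) → (∀ {x y z} → x ∼ y → y ∼ z → x ∼ z) → (f : Fin n → A) →
  (∀ i j → toℕ j ≡ suc (toℕ i) → f i ∼ f j) → ∀ i j → toℕ i < toℕ j → f i ∼ f j
steps⇒related _∼_ tr f step zero    (suc zero)    _         = step zero (suc zero) ≡.refl
steps⇒related _∼_ tr f step zero    (suc (suc j)) _         = tr (step zero (suc zero) ≡.refl)
  (steps⇒related _∼_ tr (f ∘ suc) (λ i j eq → step (suc i) (suc j) (≡.cong suc eq)) zero (suc j) (s≤s z≤n))
steps⇒related _∼_ tr f step (suc i) (suc j)       (s≤s i<j) =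
  steps⇒related _∼_ tr (f ∘ suc) (λ i j eq → step (suc i) (suc j) (≡.cong suc eq)) i j i<j

next⇒related : (_∼_ : A → A → Set) → (∀ {x} → x ∼ x) → (∀ {x y z} → x ∼ y → y ∼ z → x ∼ z) →
  (d : A) (f : Fin n → A) → (∀ i → f i ∼ next d f i) → ∀ i j → toℕ i ≤ toℕ j → f i ∼ f j
next⇒related _∼_ rf tr d f step i j i≤j with ℕ.m≤n⇒m<n∨m≡n i≤j
... | inj₁ i<j = steps⇒related _∼_ tr f
  (λ i j eq → ≡.subst (f i ∼_) (next-suc d f i j eq) (step i)) i j i<j
... | inj₂ i≡j = ≡.subst (λ k → f i ∼ f k) (toℕ-injective i≡j) rf

below≡next : ∀ {c} (π : Array b a (Fin (suc c))) i j → below π i j ≡ next 0 (λ i → toℕ (π i j)) i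
below≡next {b} π i j with suc (toℕ i) <? b
... | yes p = ≡.sym (next-suc 0 (λ i → toℕ (π i j)) i (fromℕ< p) (toℕ-fromℕ< p))
... | no ¬p = ≡.sym (next-last 0 (λ i → toℕ (π i j)) i (ℕ.≮⇒≥ ¬p))

-- Testing the single cell j = x - 1 is enough, and `x ≤ a` makes it an index.
<-ext⇒≤ : ∀ {x y} → x ≤ a → (∀ (j : Fin a) → T (toℕ j <ᵇ x) → T (toℕ j <ᵇ y)) → x ≤ y
<-ext⇒≤ {x = zero}  _   _ = z≤n
<-ext⇒≤ {x = suc x} {y} x<a f = ≡.subst (_< y) (toℕ-fromℕ< x<a)
  (ℕ.<ᵇ⇒< _ y (f (fromℕ< x<a) (ℕ.<⇒<ᵇ (ℕ.≤-reflexive (≡.cong suc (toℕ-fromℕ< x<a))))))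

T-<ᵇ-≤ : ∀ k {x y} → x ≤ y → T (k <ᵇ x) → T (k <ᵇ y)
T-<ᵇ-≤ k {x} x≤y t = ℕ.<⇒<ᵇ (ℕ.<-≤-trans (ℕ.<ᵇ⇒< k x t) x≤y)

T-<ᵇ-< : ∀ {i j} x → i ≤ j → T (j <ᵇ x) → T (i <ᵇ x)
T-<ᵇ-< {j = j} x i≤j t = ℕ.<⇒<ᵇ (ℕ.≤-<-trans i≤j (ℕ.<ᵇ⇒< j x t))

<ᵇ-⊔ : ∀ j m r → (j <ᵇ m ⊔ r) ≡ (j <ᵇ m) ∨ (j <ᵇ r)
<ᵇ-⊔ j       zero    r       = ≡.refl
<ᵇ-⊔ zero    (suc m) zero    = ≡.refl
<ᵇ-⊔ zero    (suc m) (suc r) = ≡.refl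
<ᵇ-⊔ (suc j) (suc m) zero    = ≡.sym (∨-identityʳ _)
<ᵇ-⊔ (suc j) (suc m) (suc r) = <ᵇ-⊔ j m r

≮ᵇ-suc : ∀ x v → (x <ᵇ suc v) ≡ not (v <ᵇ x)
≮ᵇ-suc zero    v       = ≡.refl
≮ᵇ-suc (suc x) zero    = ≡.refl
≮ᵇ-suc (suc x) (suc v) = ≮ᵇ-suc x v

T⇒≡true : ∀ {x} → T x → x ≡ true
T⇒≡true {true} _ = ≡.refl

≮ᵇ⇒≡false : ∀ {m n} → n ≤ m → (m <ᵇ n) ≡ false
≮ᵇ⇒≡false {m}     {zero}  _         = ≡.refl
≮ᵇ⇒≡false {suc m} {suc n} (s≤s n≤m) = ≮ᵇ⇒≡false n≤m

-- Weights regrouped from cells to levels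

module CellProducts {c ℓ₀ : Level} (R : CommutativeRing c ℓ₀) where
  open CommutativeRing R hiding (_+_; zero)
  open RingSums R
  open Exp semiring using (^-congʳ)
  open SetoidReasoning setoid

  ∏-power : ∀ a {l} m y → l ≤ a →
    ∏ (allFin a) (λ j → if (toℕ j <ᵇ l) ∧ not (toℕ j <ᵇ m) then y else 1#) ≈ y ^ (l ∸ m)
  ∏-power zero    m       y z≤n       = ^-congʳ y (≡.sym (ℕ.0∸n≡0 m))
  ∏-power (suc a) m       y z≤n       = trans (∏-1 (allFin (suc a)) (λ _ → refl)) (^-congʳ y (≡.sym (ℕ.0∸n≡0 m)))
  ∏-power (suc a) zero    y (s≤s l≤a) = trans (reflexive (∏-suc {n = a} _)) (*-congˡ (∏-power a 0 y l≤a))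
  ∏-power (suc a) (suc m) y (s≤s l≤a) = trans (reflexive (∏-suc {n = a} _))
    (trans (*-identityˡ _) (∏-power a m y l≤a))

  -- The tests single out k = p - 1, and only when r ≤ k. They are phrased as membership of the cell
  -- in level k, in level k + 1, and of the cell beneath in level k, so that each can be read off
  -- the level sets.
  ∏-descent : ∀ {c} (q : Fin c → Carrier) (p : Fin (suc c)) (r : ℕ) →
    (if r <ᵇ toℕ p then qAt R q p else 1#) ≈
    ∏ (allFin c) (λ k → if (toℕ k <ᵇ toℕ p) ∧ not ((suc (toℕ k) <ᵇ toℕ p) ∨ (toℕ k <ᵇ r)) then q k else 1#)
  ∏-descent {c}     q zero    r = sym (∏-1 (allFin c) (λ _ → refl))
  ∏-descent {suc c} q (suc p) r = trans (go p r) (reflexive (≡.sym (∏-suc {n = c} _)))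
    where
    cell : Fin (suc c) → ℕ → Fin c → Carrier
    cell p r k = if (toℕ k <ᵇ toℕ p) ∧ not ((suc (toℕ k) <ᵇ toℕ p) ∨ (suc (toℕ k) <ᵇ r)) then q (suc k) else 1#

    go : ∀ p r → (if r <ᵇ suc (toℕ p) then q p else 1#) ≈
      (if not ((0 <ᵇ toℕ p) ∨ (0 <ᵇ r)) then q zero else 1#) * ∏ (allFin c) (cell p r)
    go zero    zero    = sym (trans (*-congˡ (∏-1 (allFin c) (λ _ → refl))) (*-identityʳ _))
    go zero    (suc r) = sym (trans (*-identityˡ _) (∏-1 (allFin c) (λ _ → refl)))
    go (suc p) zero    = trans (∏-descent (q ∘ suc) (suc p) 0) (sym (*-identityˡ _))
    go (suc p) (suc r) = trans (∏-descent (q ∘ suc) (suc p) r) (sym (*-identityˡ _))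

  -- Only w = t survives: the tests place the cell in the strip between the entries at most w and
  -- the entries below w.
  ∏-evaluate : ∀ {m} (x : Fin (suc m) → Carrier) (t : Fin (suc m)) →
    x t ≈ ∏ (allFin (suc m)) (λ w → if (toℕ t <ᵇ suc (toℕ w)) ∧ not (toℕ t <ᵇ toℕ w) then x w else 1#)
  ∏-evaluate {m} x zero = sym (trans (reflexive (∏-suc {n = m} _))
    (trans (*-congˡ (∏-1 (allFin m) (λ _ → refl))) (*-identityʳ _)))
  ∏-evaluate {suc m} x (suc t) = trans (∏-evaluate (x ∘ suc) t)
    (sym (trans (reflexive (∏-suc {n = suc m} _)) (*-identityˡ _)))

  ∏-cells : ∀ b a m (f : Fin b → Fin a → Carrier) (g : Fin m → Fin b → Carrier) (h : Fin m → Fin b → Fin a → Carrier) →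
    (∀ i j → f i j ≈ ∏ (allFin m) (λ k → h k i j)) → (∀ k i → ∏ (allFin a) (h k i) ≈ g k i) →
    ∏ (allFin b) (λ i → ∏ (allFin a) (f i)) ≈ ∏ (allFin m) (λ k → ∏ (allFin b) (g k))
  ∏-cells b a m f g h f≈ ≈g = begin
    ∏ (allFin b) (λ i → ∏ (allFin a) (f i))
      ≈⟨ ∏-cong (allFin b) (λ i → trans (∏-cong (allFin a) (f≈ i)) (∏-comm (allFin a) (allFin m) (λ j k → h k i j))) ⟩
    ∏ (allFin b) (λ i → ∏ (allFin m) (λ k → ∏ (allFin a) (h k i)))
      ≈⟨ ∏-cong (allFin b) (λ i → ∏-cong (allFin m) (λ k → ≈g k i)) ⟩
    ∏ (allFin b) (λ i → ∏ (allFin m) (λ k → g k i))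
      ≈⟨ ∏-comm (allFin b) (allFin m) _ ⟩
    ∏ (allFin m) (λ k → ∏ (allFin b) (g k)) ∎

  ∏∏-guard : (p : Fin m → Fin n → Bool) (w : Fin m → Fin n → Carrier) →
    ∏ (allFin m) (λ k → ∏ (allFin n) (λ i → ⟦ p k i ⟧ * w k i)) ≈
    ⟦ ∀ᵇ m (λ k → ∀ᵇ n (p k)) ⟧ * ∏ (allFin m) (λ k → ∏ (allFin n) (w k))
  ∏∏-guard {m} {n} p w = trans (∏-cong (allFin m) (λ k → ∏-guard (p k) (w k)))
    (∏-guard (λ k → ∀ᵇ n (p k)) (λ k → ∏ (allFin n) (w k)))

-- Plane partitions as nested level sets

T-if⁻ : ∀ {x y} → T (if x then y else true) → T x → T y
T-if⁻ {true} t _ = t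

T-if⁺ : ∀ {x y} → (T x → T y) → T (if x then y else true)
T-if⁺ {true}  f = f tt
T-if⁺ {false} f = tt

isPP⁻ : ∀ {c} (π : Array b a (Fin (suc c))) → T (isPP π) → ∀ {i i′ j j′} →
  toℕ i ≤ toℕ i′ → toℕ j ≤ toℕ j′ → toℕ (π i′ j′) ≤ toℕ (π i j)
isPP⁻ π t {i} {i′} {j} {j′} i≤i′ j≤j′ = ℕ.≤ᵇ⇒≤ (toℕ (π i′ j′)) _ (T-if⁻
  (∀ᵇ⁻ _ (∀ᵇ⁻ _ (∀ᵇ⁻ _ (∀ᵇ⁻ _ t i) i′) j) j′) (T-∧⁺ (ℕ.≤⇒≤ᵇ i≤i′) (ℕ.≤⇒≤ᵇ j≤j′)))

isPP⁺ : ∀ {c} (π : Array b a (Fin (suc c))) →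
  (∀ i i′ j j′ → toℕ i ≤ toℕ i′ → toℕ j ≤ toℕ j′ → toℕ (π i′ j′) ≤ toℕ (π i j)) → T (isPP π)
isPP⁺ π mono = ∀ᵇ⁺ _ (λ i → ∀ᵇ⁺ _ (λ i′ → ∀ᵇ⁺ _ (λ j → ∀ᵇ⁺ _ (λ j′ → T-if⁺ (λ t →
  let i≤i′ = ℕ.≤ᵇ⇒≤ (toℕ i) (toℕ i′) (proj₁ (T-∧⁻ {toℕ i ≤ᵇ toℕ i′} t))
      j≤j′ = ℕ.≤ᵇ⇒≤ (toℕ j) (toℕ j′) (proj₂ (T-∧⁻ {toℕ i ≤ᵇ toℕ i′} t))
  in ℕ.≤⇒≤ᵇ (mono i i′ j j′ i≤i′ j≤j′))))))

module PlanePartitions {c₀ ℓ₀ : Level} (R : CommutativeRing c₀ ℓ₀) (a b c : ℕ)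
  (q : Fin c → CommutativeRing.Carrier R) where
  open CommutativeRing R hiding (_+_; zero)
  open RingSums R
  open Kernels R a
  open CellProducts R
  open LevelSets R id ⇔ᵇ-comm a b c
  open SetoidReasoning setoid

  private
    below′ inside : Array c b (Fin (suc a)) → Fin c → Fin b → ℕ
    inside L k i = toℕ (next zeros L k i)
    below′ L k i = next 0 (toℕ ∘ L k) i

    step : Array c b (Fin (suc a)) → Fin c → Fin b → Bool
    step L k i = (inside L k i ≤ᵇ toℕ (L k i)) ∧ (below′ L k i ≤ᵇ toℕ (L k i))

    nested : Array c b (Fin (suc a)) → Bool
    nested L = ∀ᵇ c (λ k → ∀ᵇ b (step L k))

    weight : Array c b (Fin (suc a)) → Carrier
    weight L = ∏ (allFin c) (λ k → ∏ (allFin b) (λ i → q k ^ (toℕ (L k i) ∸ (inside L k i ⊔ below′ L k i))))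

    nested⁻ : ∀ L → T (nested L) → ∀ k i → inside L k i ≤ toℕ (L k i) × below′ L k i ≤ toℕ (L k i)
    nested⁻ L t k i with T-∧⁻ {inside L k i ≤ᵇ toℕ (L k i)} (∀ᵇ⁻ (step L k) (∀ᵇ⁻ (λ k → ∀ᵇ b (step L k)) t k) i)
    ... | u , v = ℕ.≤ᵇ⇒≤ (inside L k i) _ u , ℕ.≤ᵇ⇒≤ (below′ L k i) _ v

    levels-antitone : ∀ L → T (nested L) → ∀ k k′ i → toℕ k ≤ toℕ k′ → toℕ (L k′ i) ≤ toℕ (L k i)
    levels-antitone L t k k′ i = next⇒related (λ x y → toℕ (y i) ≤ toℕ (x i)) ℕ.≤-refl (λ p q → ℕ.≤-trans q p)
      zeros L (λ k → proj₁ (nested⁻ L t k i)) k k′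

    rows-antitone : ∀ L → T (nested L) → ∀ k i i′ → toℕ i ≤ toℕ i′ → toℕ (L k i′) ≤ toℕ (L k i)
    rows-antitone L t k = next⇒related (λ x y → y ≤ x) ℕ.≤-refl (λ p q → ℕ.≤-trans q p)
      0 (toℕ ∘ L k) (λ i → proj₂ (nested⁻ L t k i))

    module _ (π : Array b a (Fin (suc c))) (L : Array c b (Fin (suc a))) (π~L : Compatible id π L) where
      inside-compatible : ∀ k i j → (suc (toℕ k) <ᵇ toℕ (π i j)) ≡ (toℕ j <ᵇ inside L k i)
      -- Past the last level the default `zeros` is right, because no entry exceeds c.
      inside-compatible k i j = next-rel (λ k s _ → (k <ᵇ toℕ (π i j)) ≡ (toℕ j <ᵇ toℕ (s i))) L L
        {zeros} {zeros} (λ k → π~L k i j) (≮ᵇ⇒≡false (toℕ≤pred[n] (π i j))) k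

      below-compatible : ∀ k i j → (toℕ k <ᵇ below π i j) ≡ (toℕ j <ᵇ below′ L k i)
      below-compatible k i j = ≡.trans (≡.cong (toℕ k <ᵇ_) (below≡next π i j))
        (next-rel (λ _ x y → (toℕ k <ᵇ x) ≡ (toℕ j <ᵇ y)) (λ i → toℕ (π i j)) (toℕ ∘ L k)
          (λ i → π~L k i j) ≡.refl i)

      isPP⇒nested : T (isPP π) → T (nested L)
      isPP⇒nested t = ∀ᵇ⁺ _ (λ k → ∀ᵇ⁺ (step L k) (λ i → T-∧⁺
        (ℕ.≤⇒≤ᵇ (<-ext⇒≤ (toℕ≤pred[n] (next zeros L k i)) (λ j u →
          ≡.subst T (π~L k i j) (T-<ᵇ-< (toℕ (π i j)) (ℕ.n≤1+n (toℕ k))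
            (≡.subst T (≡.sym (inside-compatible k i j)) u)))))
        (ℕ.≤⇒≤ᵇ (next-elim (_≤ toℕ (L k i)) 0 (toℕ ∘ L k) i z≤n (λ i′ eq →
          <-ext⇒≤ (toℕ≤pred[n] (L k i′)) (λ j u → ≡.subst T (π~L k i j) (T-<ᵇ-≤ (toℕ k)
            (isPP⁻ π t (≡.subst (toℕ i ≤_) (≡.sym eq) (ℕ.n≤1+n _)) (ℕ.≤-refl {toℕ j}))
            (≡.subst T (≡.sym (π~L k i′ j)) u))))))))

      nested⇒isPP : T (nested L) → T (isPP π)
      nested⇒isPP t = isPP⁺ π (λ i i′ j j′ i≤i′ j≤j′ → <-ext⇒≤ (toℕ≤pred[n] (π i′ j′)) (λ k u →
        ≡.subst T (≡.sym (π~L k i j)) (T-<ᵇ-≤ (toℕ j) (rows-antitone L t k i i′ i≤i′)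
          (T-<ᵇ-< (toℕ (L k i′)) j≤j′ (≡.subst T (π~L k i′ j′) u)))))

      -- Descents with entry k + 1 in row i are the cells of level k that lie outside level k + 1
      -- and have no cell of level k beneath them: the columns from `inside ⊔ below′` up to the end
      -- of the row, which is the pushing exponent.
      gWeight≈weight : gWeight R q π ≈ weight L
      gWeight≈weight = ∏-cells b a c _ _
        (λ k i j → if (toℕ j <ᵇ toℕ (L k i)) ∧ not (toℕ j <ᵇ inside L k i ⊔ below′ L k i) then q k else 1#)
        (λ i j → trans (∏-descent q (π i j) (below π i j)) (∏-cong (allFin c) (λ k →
          reflexive (≡.cong (λ x → if x then q k else 1#) (≡.cong₂ (λ x y → x ∧ not y) (π~L k i j)
            (≡.trans (≡.cong₂ _∨_ (inside-compatible k i j) (below-compatible k i j))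
              (≡.sym (<ᵇ-⊔ (toℕ j) (inside L k i) (below′ L k i)))))))))
        (λ k i → ∏-power a (inside L k i ⊔ below′ L k i) (q k) (toℕ≤pred[n] (L k i)))

  gWeightλ₁≤≈groth : gWeightλ₁≤ R a b c q ≈ (allOnes {b} ◁[ grothKernel ] q) ∅
  gWeightλ₁≤≈groth = begin
    gWeightλ₁≤ R a b c q
      ≈⟨ ∑-filter isPP arrays (gWeight R q) ⟩
    ∑ arrays (λ π → ⟦ isPP π ⟧ * gWeight R q π)
      ≈⟨ ∑-arrays≈∑-levels _ _
           (λ π → [ inj₁ , (λ t → inj₂ (λ k i {j} {j′} j≤j′ →
             T-<ᵇ-≤ (toℕ k) (isPP⁻ π t (ℕ.≤-refl {toℕ i}) j≤j′))) ]′ (guard-dichotomy (isPP π)))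
           (λ L → [ inj₁ , (λ t → inj₂ (λ i j {k} {k′} k≤k′ →
             T-<ᵇ-≤ (toℕ j) (levels-antitone L t k k′ i k≤k′))) ]′ (guard-dichotomy (nested L)))
           (λ π L π~L → guard-≡ (T-ext (isPP⇒nested π L π~L) (nested⇒isPP π L π~L))
             (λ _ → gWeight≈weight π L π~L)) ⟩
    ∑ levels (λ L → ⟦ nested L ⟧ * weight L)
      ≈⟨ ∑-cong levels (λ L → trans (*-identityˡ _) (trans
           (∏-cong (allFin c) (λ k → grothKernel-tabulate (q k) (L k) (next zeros L k)))
           (∏∏-guard (step L) (λ k i → q k ^ (toℕ (L k i) ∸ (inside L k i ⊔ below′ L k i)))))) ⟨
    ∑ levels (λ L → 1# * ∏ (allFin c) (λ k → grothKernel (q k) (tabulateᵛ (L k)) (tabulateᵛ (next zeros L k))))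
      ≈⟨ ∑-chains grothKernel c q allOnes ⟩
    (allOnes {b} ◁[ grothKernel ] q) ∅ ∎

-- Semistandard tableaux as chains of horizontal strips

module Tableaux {c₀ ℓ₀ : Level} (R : CommutativeRing c₀ ℓ₀) (a b m : ℕ)
  (x : Fin (suc m) → CommutativeRing.Carrier R) where
  open CommutativeRing R hiding (_+_; zero)
  open RingSums R
  open Kernels R a
  open CellProducts R
  open LevelSets R not ⇔ᵇ-not-comm a b m
  open SetoidReasoning setoid

  private
    -- For a compatible tableau these are the shapes of the entries below w and of those at most w.
    -- The m level sets are completed by the empty shape, as no letter is below 0, and by the full
    -- rectangle, as all letters are at most m.
    lower upper : Array m b (Fin (suc a)) → Fin (suc m) → Fin b → Fin (suc a)
    lower L = zeros ∷ᶠ L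
    upper L = next tops (lower L)

    step : Array m b (Fin (suc a)) → Fin (suc m) → Fin b → Bool
    step L w i = (toℕ (lower L w i) ≤ᵇ toℕ (upper L w i)) ∧
                 (next 0 (toℕ ∘ upper L w) i ≤ᵇ toℕ (lower L w i))

    interlacing : Array m b (Fin (suc a)) → Bool
    interlacing L = ∀ᵇ (suc m) (λ w → ∀ᵇ b (step L w))

    weight : Array m b (Fin (suc a)) → Carrier
    weight L = ∏ (allFin (suc m)) (λ w → ∏ (allFin b) (λ i →
      x w ^ (toℕ (upper L w i) ∸ toℕ (lower L w i))))

    interlacing⁻ : ∀ L → T (interlacing L) → ∀ w i →
      toℕ (lower L w i) ≤ toℕ (upper L w i) × next 0 (toℕ ∘ upper L w) i ≤ toℕ (lower L w i)
    interlacing⁻ L t w i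
      with T-∧⁻ {toℕ (lower L w i) ≤ᵇ toℕ (upper L w i)} (∀ᵇ⁻ (step L w) (∀ᵇ⁻ (λ w → ∀ᵇ b (step L w)) t w) i)
    ... | u , v = ℕ.≤ᵇ⇒≤ (toℕ (lower L w i)) _ u , ℕ.≤ᵇ⇒≤ (next 0 (toℕ ∘ upper L w) i) _ v

    levels-monotone : ∀ L → T (interlacing L) → ∀ k k′ i → toℕ k ≤ toℕ k′ → toℕ (L k i) ≤ toℕ (L k′ i)
    levels-monotone L t k k′ i k≤k′ = next⇒related (λ r s → toℕ (r i) ≤ toℕ (s i)) ℕ.≤-refl ℕ.≤-trans
      tops (lower L) (λ w → proj₁ (interlacing⁻ L t w i)) (suc k) (suc k′) (s≤s k≤k′)

    isSSYT⁻ : (S : Array b a (Fin (suc m))) → T (isSSYT R S) → ∀ i i′ j j′ →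
      (toℕ j ≤ toℕ j′ → toℕ (S i j) ≤ toℕ (S i j′)) × (toℕ i < toℕ i′ → toℕ (S i j) < toℕ (S i′ j))
    isSSYT⁻ S t i i′ j j′
      with T-∧⁻ {if (toℕ j ≤ᵇ toℕ j′) then toℕ (S i j) ≤ᵇ toℕ (S i j′) else true}
             (∀ᵇ⁻ _ (∀ᵇ⁻ _ (∀ᵇ⁻ _ (∀ᵇ⁻ _ t i) i′) j) j′)
    ... | u , v = (λ j≤j′ → ℕ.≤ᵇ⇒≤ (toℕ (S i j)) _ (T-if⁻ u (ℕ.≤⇒≤ᵇ j≤j′))) ,
                  (λ i<i′ → ℕ.<ᵇ⇒< (toℕ (S i j)) _ (T-if⁻ v (ℕ.<⇒<ᵇ i<i′)))

    isSSYT⁺ : (S : Array b a (Fin (suc m))) →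
      (∀ i j j′ → toℕ j ≤ toℕ j′ → toℕ (S i j) ≤ toℕ (S i j′)) →
      (∀ i i′ j → toℕ i < toℕ i′ → toℕ (S i j) < toℕ (S i′ j)) → T (isSSYT R S)
    isSSYT⁺ S rows columns = ∀ᵇ⁺ _ (λ i → ∀ᵇ⁺ _ (λ i′ → ∀ᵇ⁺ _ (λ j → ∀ᵇ⁺ _ (λ j′ → T-∧⁺
      (T-if⁺ (λ t → ℕ.≤⇒≤ᵇ (rows i j j′ (ℕ.≤ᵇ⇒≤ (toℕ j) _ t))))
      (T-if⁺ (λ t → ℕ.<⇒<ᵇ (columns i i′ j (ℕ.<ᵇ⇒< (toℕ i) _ t))))))))

    module _ (S : Array b a (Fin (suc m))) (L : Array m b (Fin (suc a))) (S~L : Compatible not S L) where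
      entry<suc : ∀ k i j → (toℕ (S i j) <ᵇ suc (toℕ k)) ≡ (toℕ j <ᵇ toℕ (L k i))
      entry<suc k i j = ≡.trans (≮ᵇ-suc (toℕ (S i j)) (toℕ k))
        (≡.trans (≡.cong not (S~L k i j)) (not-involutive _))

      lower-compatible : ∀ w i j → (toℕ (S i j) <ᵇ toℕ w) ≡ (toℕ j <ᵇ toℕ (lower L w i))
      lower-compatible zero    i j = ≡.refl
      lower-compatible (suc k) i j = entry<suc k i j

      upper-compatible : ∀ w i j → (toℕ (S i j) <ᵇ suc (toℕ w)) ≡ (toℕ j <ᵇ toℕ (upper L w i))
      upper-compatible w i j = next-rel (λ w s _ → (toℕ (S i j) <ᵇ w) ≡ (toℕ j <ᵇ toℕ (s i)))
        (lower L) (lower L) {tops} {tops} (λ w → lower-compatible w i j)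
        (≡.trans (T⇒≡true (ℕ.<⇒<ᵇ (toℕ<n (S i j))))
          (≡.sym (T⇒≡true (ℕ.<⇒<ᵇ (≡.subst (toℕ j <_) (≡.sym (toℕ-fromℕ a)) (toℕ<n j)))))) w

      isSSYT⇒interlacing : T (isSSYT R S) → T (interlacing L)
      isSSYT⇒interlacing t = ∀ᵇ⁺ _ (λ w → ∀ᵇ⁺ (step L w) (λ i → T-∧⁺
        (ℕ.≤⇒≤ᵇ (<-ext⇒≤ (toℕ≤pred[n] (lower L w i)) (λ j u → ≡.subst T (upper-compatible w i j)
          (T-<ᵇ-≤ (toℕ (S i j)) (ℕ.n≤1+n (toℕ w)) (≡.subst T (≡.sym (lower-compatible w i j)) u)))))
        (ℕ.≤⇒≤ᵇ (next-elim (_≤ toℕ (lower L w i)) 0 (toℕ ∘ upper L w) i z≤n (λ i′ eq →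
          <-ext⇒≤ (toℕ≤pred[n] (upper L w i′)) (λ j u → ≡.subst T (lower-compatible w i j) (ℕ.<⇒<ᵇ
            (ℕ.<-≤-trans (proj₂ (isSSYT⁻ S t i i′ j j) (ℕ.≤-reflexive (≡.sym eq)))
              (ℕ.≤-pred (ℕ.<ᵇ⇒< (toℕ (S i′ j)) _ (≡.subst T (≡.sym (upper-compatible w i′ j)) u)))))))))))

      entry-in-upper : ∀ i j → T (toℕ j <ᵇ toℕ (upper L (S i j) i))
      entry-in-upper i j = ≡.subst T (upper-compatible (S i j) i j) (ℕ.<⇒<ᵇ (ℕ.n<1+n (toℕ (S i j))))

      interlacing⇒isSSYT : T (interlacing L) → T (isSSYT R S)
      interlacing⇒isSSYT t = isSSYT⁺ S
        (λ i j j′ j≤j′ → ℕ.≤-pred (ℕ.<ᵇ⇒< (toℕ (S i j)) _ (≡.subst T (≡.sym (upper-compatible (S i j′) i j))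
          (T-<ᵇ-< (toℕ (upper L (S i j′) i)) j≤j′ (entry-in-upper i j′)))))
        -- Take w = S i′ j with i′ just below i. The cell (i′, j) lies in the upper shape at w, so
        -- by interlacing (i, j) lies in the lower shape, which means S i j < w.
        (λ i i′ j → steps⇒related _<_ ℕ.<-trans (λ i → toℕ (S i j)) (λ i i′ eq →
          ℕ.<ᵇ⇒< (toℕ (S i j)) _ (≡.subst T (≡.sym (lower-compatible (S i′ j) i j))
            (T-<ᵇ-≤ (toℕ j) (≡.subst (_≤ toℕ (lower L (S i′ j) i)) (next-suc 0 (toℕ ∘ upper L (S i′ j)) i i′ eq)
              (proj₂ (interlacing⁻ L t (S i′ j) i))) (entry-in-upper i′ j)))) i i′)

      monomial≈weight : ∏ (allFin b) (λ i → ∏ (allFin a) (λ j → x (S i j))) ≈ weight L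
      monomial≈weight = ∏-cells b a (suc m) _ _
        (λ w i j → if (toℕ j <ᵇ toℕ (upper L w i)) ∧ not (toℕ j <ᵇ toℕ (lower L w i)) then x w else 1#)
        (λ i j → trans (∏-evaluate x (S i j)) (∏-cong (allFin (suc m)) (λ w →
          reflexive (≡.cong (λ y → if y then x w else 1#)
            (≡.cong₂ (λ y z → y ∧ not z) (upper-compatible w i j) (lower-compatible w i j))))))
        (λ w i → ∏-power a (toℕ (lower L w i)) (x w) (toℕ≤pred[n] (upper L w i)))

  schurRect≈schur : schurRect R a b (suc m) x ≈ (isFull {b} ◁[ schurKernel ] x) ∅
  schurRect≈schur = begin
    schurRect R a b (suc m) x
      ≈⟨ ∑-filter (isSSYT R) arrays monomial ⟩
    ∑ arrays (λ S → ⟦ isSSYT R S ⟧ * monomial S)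
      ≈⟨ ∑-arrays≈∑-levels _ _
           (λ S → [ inj₁ , (λ t → inj₂ (λ k i {j} {j′} j≤j′ → T-not (T-<ᵇ-≤ (toℕ k)
             (proj₁ (isSSYT⁻ S t i i j j′) j≤j′)))) ]′ (guard-dichotomy (isSSYT R S)))
           (λ L → [ inj₁ , (λ t → inj₂ (λ i j {k} {k′} k≤k′ → T-not (T-<ᵇ-≤ (toℕ j)
             (levels-monotone L t k k′ i k≤k′)))) ]′ (guard-dichotomy (interlacing L)))
           (λ S L S~L → guard-≡ (T-ext (isSSYT⇒interlacing S L S~L) (interlacing⇒isSSYT S L S~L))
             (λ _ → monomial≈weight S L S~L)) ⟩
    ∑ levels (λ L → ⟦ interlacing L ⟧ * weight L)
      ≈⟨ ∑-cong levels (λ L → trans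
           (∏-cong (allFin (suc m)) (λ w → schurKernel-tabulate (x w) (upper L w) (lower L w)))
           (∏∏-guard (step L) (λ w i → x w ^ (toℕ (upper L w i) ∸ toℕ (lower L w i))))) ⟨
    ∑ levels (λ L → ∏ (allFin (suc m)) (λ w →
      schurKernel (x w) (tabulateᵛ (upper L w)) (tabulateᵛ (lower L w))))
      ≈⟨ ∑-schurChains m x zeros ⟩
    (isFull {b} ◁[ schurKernel ] x) ∅ ∎
    where
    monomial : Array b a (Fin (suc m)) → Carrier
    monomial S = ∏ (allFin b) (λ i → ∏ (allFin a) (λ j → x (S i j)))

theorem7p3 : ∀ {c₀ ℓ₀} (R : CommutativeRing c₀ ℓ₀) (a b c : ℕ) →
    1 ≤ a → 1 ≤ b → 1 ≤ c →
    (q : Fin c → CommutativeRing.Carrier R) →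
    CommutativeRing._≈_ R (gWeightλ₁≤ R a b c q)
    (schurRect R a b (b + c) (onesThen R b c q))
theorem7p3 R a (suc b) c _ _ _ q = begin
  gWeightλ₁≤ R a (suc b) c q
    ≈⟨ PlanePartitions.gWeightλ₁≤≈groth R a (suc b) c q ⟩
  (allOnes ◁[ grothKernel ] q) ∅
    ≈⟨ groth≈schur (suc b) c q ⟩
  (isFull ◁[ schurKernel ] onesThen R (suc b) c q) ∅
    -- An alphabet of suc m letters has m intermediate level sets; positivity of the number of rows
    -- makes the alphabet size a successor, with m = b + c for the predecessor b.
    ≈⟨ Tableaux.schurRect≈schur R a (suc b) (b + c) (onesThen R (suc b) c q) ⟨
  schurRect R a (suc b) (suc b + c) (onesThen R (suc b) c q) ∎
  where
  open CommutativeRing R using (setoid)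
  open Kernels R a
  open SetoidReasoning setoid
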